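{- Let $q$ be an odd prime power and $r>2$, $n\ge1$ integers. If an $(n-1)$-spread $\mathcal{S}$ of $\mathrm{PG}(rn-1,q)$ contains at least $r+1$ normal elements such that some $r$ of these elements span the whole space $\mathrm{PG}(rn-1,q)$, then $\mathcal{S}$ is Desarguesian.
   Context: An $(n-1)$-spread of $\mathrm{PG}(N-1,q)$ is a set of $(n-1)$-dimensional subspaces partitioning the point set. An element $E$ of an $(n-1)$-spread $\mathcal{S}$ of $\mathrm{PG}(rn-1,q)$ is normal if for every $F\in\mathcal{S}\setminus\{E\}$ the $(2n-1)$-space $\langle E,F\rangle$ is partitioned by elements of $\mathcal{S}$. A Desarguesian spread of $\mathrm{PG}(rn-1,q)$ is (any spread projectively equivalent to) the spread obtained by field reduction: regard $\mathbb{F}_{q^n}^r$ as an $rn$-dimensional $\mathbb{F}_q$-vector space; its $1$-dimensional $\mathbb{F}_{q^n}$-subspaces become $(n-1)$-spaces of $\mathrm{PG}(rn-1,q)$, forming the spread. -}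

module Defs where

open import Data.Nat using (ℕ; zero; suc; _^_)
import Data.Nat as Nat
open import Data.Nat.Primality using (Prime)
open import Data.Nat.Divisibility using (_∣_)
open import Data.Fin using (Fin)
open import Data.Product using (Σ; ∃; _×_; _,_)
open import Data.Sum using (_⊎_; [_,_])
open import Relation.Nullary using (¬_)
open import Relation.Binary.PropositionalEquality using (_≡_; _≢_)
open import Algebra.Structures using (IsCommutativeRing)
open import Function.Bundles using (_↔_; _⇔_)

record Field : Set₁ where
  infixl 6 _+_
  infixl 7 _*_
  field
    Carrier : Set
    _+_ _*_ : Carrier → Carrier → Carrier
    -_      : Carrier → Carrier
    0# 1#   : Carrier
    isCommutativeRing : IsCommutativeRing _≡_ _+_ _*_ -_ 0# 1#
    0≢1     : 0# ≢ 1#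
    inverse : ∀ x → x ≢ 0# → ∃ λ y → x * y ≡ 1#

HasOrder : Field → ℕ → Set
HasOrder F q = Fin q ↔ Field.Carrier F

OddPrimePower : ℕ → Set
OddPrimePower q = Σ ℕ λ p → Σ ℕ λ k → Prime p × ¬ (2 ∣ p) × q ≡ p ^ suc k

record FieldHom (F K : Field) : Set where
  private
    module F = Field F
    module K = Field K
  field
    map    : F.Carrier → K.Carrier
    map-+  : ∀ a b → map (a F.+ b) ≡ map a K.+ map b
    map-*  : ∀ a b → map (a F.* b) ≡ map a K.* map b
    map-1  : map F.1# ≡ K.1#

module VectorSpace (F : Field) where
  open Field F

  Vect : ℕ → Set
  Vect N = Fin N → Carrier

  _≈_ : ∀ {N} → Vect N → Vect N → Set
  u ≈ v = ∀ i → u i ≡ v i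

  0v : ∀ {N} → Vect N
  0v _ = 0#

  _+v_ : ∀ {N} → Vect N → Vect N → Vect N
  (u +v v) i = u i + v i

  _·_ : ∀ {N} → Carrier → Vect N → Vect N
  (a · v) i = a * v i

  -- nonzero vector (= a point of the projective space)
  NonZero : ∀ {N} → Vect N → Set
  NonZero v = ∃ λ i → v i ≢ 0#

  lincomb : ∀ {N} m → (Fin m → Carrier) → (Fin m → Vect N) → Vect N
  lincomb zero    c b = 0v
  lincomb (suc m) c b = (c Fin.zero · b Fin.zero) +v lincomb m (λ i → c (Fin.suc i)) (λ i → b (Fin.suc i))
    where import Data.Fin as Fin

  LinearlyIndependent : ∀ {N m} → (Fin m → Vect N) → Set
  LinearlyIndependent {m = m} b = ∀ c → lincomb m c b ≈ 0v → ∀ i → c i ≡ 0#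

  data InSpan {N} {A : Set} (g : A → Vect N) : Vect N → Set where
    span-0    : InSpan g 0v
    span-gen  : ∀ a → InSpan g (g a)
    span-+    : ∀ {u v} → InSpan g u → InSpan g v → InSpan g (u +v v)
    span-·    : ∀ {v} c → InSpan g v → InSpan g (c · v)
    span-resp : ∀ {u v} → u ≈ v → InSpan g u → InSpan g v

-- Spreads.  An (n-1)-spread of PG(N-1,q) is given as a family of
-- (n-1)-dimensional projective subspaces, each given by a basis
-- (n linearly independent vectors of F^N), indexed by a type I, such
-- that every point lies in exactly one element.

record Spread (F : Field) (N n : ℕ) : Set₁ where
  open VectorSpace F
  field
    Index   : Set
    basis   : Index → Fin n → Vect N
    indep   : ∀ i → LinearlyIndependent (basis i)
    covers  : ∀ v → NonZero v → ∃ λ i → InSpan (basis i) v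
    disjoint : ∀ i j v → NonZero v → InSpan (basis i) v → InSpan (basis j) v → i ≡ j

module _ {F : Field} {N n : ℕ} (S : Spread F N n) where
  open VectorSpace F
  open Spread S

  join : Index → Index → (Fin n ⊎ Fin n) → Vect N
  join i j = [ basis i , basis j ]

  -- E_i is normal: for every other element E_j, ⟨E_i,E_j⟩ is partitioned by
  -- spread elements, i.e. every point of ⟨E_i,E_j⟩ lies in a spread element
  -- contained in ⟨E_i,E_j⟩.
  Normal : Index → Set
  Normal i = ∀ j → j ≢ i → ∀ v → NonZero v → InSpan (join i j) v →
             ∃ λ k → InSpan (basis k) v × (∀ u → InSpan (basis k) u → InSpan (join i j) u)

-- Desarguesian spread of PG(rn-1,q): there is an extension field K of F
-- (embedding σ : F → K) and an F-semilinear bijection φ : F^{rn} → K^r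
-- (φ(u+v) = φu+φv, φ(a v) = σ(a) φ(v)) mapping the elements of S exactly
-- onto the 1-dimensional K-subspaces of K^r (field reduction up to
-- projective equivalence).

Desarguesian : {F : Field} (r n : ℕ) → Spread F (r Nat.* n) n → Set₁
Desarguesian {F} r n S =
  Σ Field λ K → Σ (FieldHom F K) λ σ → Σ (Vect (r Nat.* n) → KV K) λ φ →
    let open Field K using () renaming (_+_ to _+K_; _*_ to _*K_; 0# to 0K)
        σm = FieldHom.map σ
        _≈K_ : KV K → KV K → Set
        u ≈K w = ∀ a → u a ≡ w a
    in (∀ u v → u ≈ v → φ u ≈K φ v)
     × (∀ u v → φ (u +v v) ≈K (λ a → φ u a +K φ v a))
     × (∀ c v → φ (c · v) ≈K (λ a → σm c *K φ v a))
     × (∀ u v → φ u ≈K φ v → u ≈ v)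
     × (∀ w → ∃ λ v → φ v ≈K w)
     × (∀ i → ∃ λ (w : KV K) → (∃ λ (a : Fin r) → w a ≢ 0K) ×
          (∀ v → InSpan (basis i) v ⇔ (∃ λ (λ' : Field.Carrier K) → φ v ≈K (λ a → λ' *K w a))))
     × (∀ (w : KV K) → (∃ λ (a : Fin r) → w a ≢ 0K) → ∃ λ i →
          (∀ v → InSpan (basis i) v ⇔ (∃ λ (λ' : Field.Carrier K) → φ v ≈K (λ a → λ' *K w a))))
  where
    open VectorSpace F
    open Spread S
    KV : Field → Set
    KV K = Fin r → Field.Carrier K

{-# OPTIONS --safe #-}
module Submission where

-- Write V = W^r with the r spanning elements as coordinate subspaces.  Normality of these makes
-- every coordinate projection of a spread element again a spread element, so the spread is
-- determined by what it induces on pairs of coordinates.  Rescaling the coordinates so that the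
-- diagonal {(x , … , x)} belongs to the spread, all pairs carry the same family of linear maps,
-- which is closed under composition and sharply transitive on W∖0: W becomes a nearfield in which
-- the elements are the left lines {(s w₁ , … , s w_r)}.  The extra normal element, arranged to be a
-- projection of the diagonal, supplies the missing distributive law.  Hence W is a finite division
-- ring, and a field by Wedderburn's theorem.
--
-- Wedderburn's theorem is proved on a minimal noncommutative P.  Let K be the centralizer of a
-- noncentral a; it is commutative.  Some x ∉ K normalizes K, by decomposing P into eigenspaces of
-- conjugation by a with characters of K*.  If t is minimal with x^t ∈ K, Hilbert 90 and counting
-- give k ∈ K* with (k x)^t = 1.  By orthogonality of characters Σ_{i<t} (k x)^i c ≠ 0 for some
-- c ∈ K*; this sum is fixed by k x, so k x = 1 and x ∈ K, a contradiction.

open import Defs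
open import Algebra.Bundles using (AbelianGroup; CommutativeRing; Ring)
open import Algebra.Structures using (IsAbelianGroup; IsRing)
open import Data.Empty using (⊥)
open import Data.Fin as Fin using (Fin; combine; finToFun; funToFin; punchIn; punchOut; toℕ)
open import Data.Fin.Permutation using (permutation)
import Data.Fin.Properties as Fin
open import Data.Nat as ℕ using (ℕ; zero; suc)
import Data.Nat.Divisibility as ℕ
import Data.Nat.Induction as ℕ
import Data.Nat.Properties as ℕ
open import Data.Product using (Σ; ∃; ∃₂; _×_; _,_; proj₁; proj₂)
open import Data.Sum using (_⊎_; inj₁; inj₂; [_,_]; [_,_]′)
open import Data.Unit using (⊤; tt)
open import Function using (_∘_)
open import Function.Bundles using (Equivalence; Inverse; _⇔_; mk⇔)
open import Function.Definitions using (Injective)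
open import Induction.WellFounded using (Acc; acc)
open import Level using (0ℓ)
open import Relation.Binary.PropositionalEquality hiding ([_])
open import Relation.Nullary using (¬_; Dec; yes; no; contradiction)
open import Relation.Nullary.Decidable using (_×-dec_; _⊎-dec_; _→-dec_; ¬?; decidable-stable; map′)
open import Relation.Unary using (Decidable)
open import Tactic.MonoidSolver using (solve)

-- Finite sets

-- Counting replaces dimension theory: an injection between finite sets of equal size is onto. This
-- makes the spanning elements a direct sum, makes every nonzero coordinate projection of a spread
-- element a bijection onto W, and closes the proof of Wedderburn's theorem. Vectors are therefore
-- coded by numbers, W being `Fin (q ^ n)` with decidable propositional equality. The third
-- coordinate, available because r > 2, carries the algebra. Composing slopes from one coordinate to
-- a second and on to a third gives associativity, and a third coordinate of the split along the
-- extra normal element yields the factor -x in the missing distributive law. The characters of K*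
-- take values in the ring itself. There the number of units of K is -1, so summing over K* isolates
-- one term up to sign, without roots of unity or division by a group order.

injective⇒surjective : ∀ {n} (f : Fin n → Fin n) → Injective _≡_ _≡_ f → ∀ y → ∃ λ x → f x ≡ y
injective⇒surjective {suc n} f inj y with Fin.any? (λ x → f x Fin.≟ y)
... | yes hit = hit
... | no miss = contradiction (Fin.injective⇒≤ {f = g} g-inj) ℕ.1+n≰n
  where
  y≢f : ∀ x → y ≢ f x
  y≢f x y≡fx = miss (x , sym y≡fx)
  g : Fin (suc n) → Fin n
  g x = punchOut (y≢f x)
  g-inj : Injective _≡_ _≡_ g
  g-inj {x} {x′} eq = inj (Fin.punchOut-injective (y≢f x) (y≢f x′) eq)

least : {P : ℕ → Set} → Decidable P → ∀ n → P n → ∃ λ l → P l × (∀ j → j ℕ.< l → ¬ P j)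
least P? zero p = zero , p , λ _ ()
least P? (suc n) p with P? 0
... | yes p₀ = 0 , p₀ , λ _ ()
... | no ¬p₀ with least (P? ∘ suc) n p
...   | l , pl , below = suc l , pl , λ { zero _ → ¬p₀ ; (suc j) (ℕ.s≤s j<l) → below j j<l }

choose : {A P : Set} → Dec P → A → A → A
choose (yes _) x y = x
choose (no _)  x y = y

choose-yes : ∀ {A P : Set} (P? : Dec P) {x y : A} → P → choose P? x y ≡ x
choose-yes (yes _) p = refl
choose-yes (no ¬p) p = contradiction p ¬p

choose-no : ∀ {A P : Set} (P? : Dec P) {x y : A} → ¬ P → choose P? x y ≡ y
choose-no (yes p) ¬p = contradiction p ¬p
choose-no (no _)  ¬p = refl

count : ∀ {n} {P : Fin n → Set} → Decidable P → ℕ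
count {zero} P? = 0
count {suc n} P? with P? Fin.zero
... | yes _ = suc (count (P? ∘ Fin.suc))
... | no _ = count (P? ∘ Fin.suc)

count-mono : ∀ {n} {P Q : Fin n → Set} (P? : Decidable P) (Q? : Decidable Q) →
             (∀ x → P x → Q x) → count P? ℕ.≤ count Q?
count-mono {zero} P? Q? P⊆Q = ℕ.z≤n
count-mono {suc n} P? Q? P⊆Q with P? Fin.zero | Q? Fin.zero
... | yes p | yes _ = ℕ.s≤s (count-mono (P? ∘ Fin.suc) (Q? ∘ Fin.suc) (P⊆Q ∘ Fin.suc))
... | yes p | no ¬q = contradiction (P⊆Q _ p) ¬q
... | no _  | yes _ = ℕ.m≤n⇒m≤1+n (count-mono (P? ∘ Fin.suc) (Q? ∘ Fin.suc) (P⊆Q ∘ Fin.suc))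
... | no _  | no _ = count-mono (P? ∘ Fin.suc) (Q? ∘ Fin.suc) (P⊆Q ∘ Fin.suc)

count-mono-< : ∀ {n} {P Q : Fin n → Set} (P? : Decidable P) (Q? : Decidable Q) →
               (∀ x → P x → Q x) → ∀ x → Q x → ¬ P x → count P? ℕ.< count Q?
count-mono-< {suc n} P? Q? P⊆Q Fin.zero q ¬p with P? Fin.zero | Q? Fin.zero
... | yes p | _ = contradiction p ¬p
... | no _ | no ¬q = contradiction q ¬q
... | no _ | yes _ = ℕ.s≤s (count-mono (P? ∘ Fin.suc) (Q? ∘ Fin.suc) (P⊆Q ∘ Fin.suc))
count-mono-< {suc n} P? Q? P⊆Q (Fin.suc x) q ¬p with P? Fin.zero | Q? Fin.zero
... | yes p | yes _ = ℕ.s≤s (count-mono-< (P? ∘ Fin.suc) (Q? ∘ Fin.suc) (P⊆Q ∘ Fin.suc) x q ¬p)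
... | yes p | no ¬q = contradiction (P⊆Q _ p) ¬q
... | no _  | yes _ = ℕ.m≤n⇒m≤1+n (count-mono-< (P? ∘ Fin.suc) (Q? ∘ Fin.suc) (P⊆Q ∘ Fin.suc) x q ¬p)
... | no _  | no _ = count-mono-< (P? ∘ Fin.suc) (Q? ∘ Fin.suc) (P⊆Q ∘ Fin.suc) x q ¬p

-- Finite division rings

record FiniteDivisionRing (m : ℕ) : Set where
  infixl 6 _+_
  infixl 7 _*_
  field
    _+_ _*_ : Fin m → Fin m → Fin m
    -_      : Fin m → Fin m
    0# 1#   : Fin m
    isRing  : IsRing _≡_ _+_ _*_ -_ 0# 1#
    0≢1     : 0# ≢ 1#
    -- Left inverses, as `⊛-inverse` supplies them; `inverseʳ` derives the other side.
    inverse : ∀ x → x ≢ 0# → ∃ λ y → y * x ≡ 1#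

module DivisionRingProperties {m : ℕ} (D : FiniteDivisionRing m) where
  open FiniteDivisionRing D using (isRing; 0≢1; inverse)

  ring : Ring 0ℓ 0ℓ
  ring = record { isRing = isRing }

  open Ring ring hiding (refl; sym; trans; reflexive; isRing)
  open import Algebra.Properties.Ring ring
  open import Algebra.Properties.Semiring.Sum semiring
  open import Algebra.Properties.Semiring.Exp semiring
  open ≡-Reasoning

  infix 9 _⁻¹
  _⁻¹ : Fin m → Fin m
  x ⁻¹ with x Fin.≟ 0#
  ... | yes _ = 0#
  ... | no x≢0 = proj₁ (inverse x x≢0)

  inverseˡ : ∀ {x} → x ≢ 0# → x ⁻¹ * x ≡ 1#
  inverseˡ {x} x≢0 with x Fin.≟ 0#
  ... | yes x≡0 = contradiction x≡0 x≢0
  ... | no x≢0′ = proj₂ (inverse x x≢0′)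

  *-cancelˡ : ∀ x {y z} → x ≢ 0# → x * y ≡ x * z → y ≡ z
  *-cancelˡ x {y} {z} x≢0 eq = begin
    y              ≡⟨ lemma y ⟨
    x ⁻¹ * (x * y) ≡⟨ cong (x ⁻¹ *_) eq ⟩
    x ⁻¹ * (x * z) ≡⟨ lemma z ⟩
    z              ∎
    where
    lemma : ∀ w → x ⁻¹ * (x * w) ≡ w
    lemma w = trans (sym (*-assoc _ _ _)) (trans (cong (_* w) (inverseˡ x≢0)) (*-identityˡ w))

  *-nonzero : ∀ {x y} → x ≢ 0# → y ≢ 0# → x * y ≢ 0#
  *-nonzero {x} x≢0 y≢0 xy≡0 = y≢0 (*-cancelˡ x x≢0 (trans xy≡0 (sym (zeroʳ x))))

  ⁻¹-nonzero : ∀ {x} → x ≢ 0# → x ⁻¹ ≢ 0#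
  ⁻¹-nonzero {x} x≢0 eq = 0≢1 (trans (sym (zeroˡ x)) (trans (cong (_* x) (sym eq)) (inverseˡ x≢0)))

  inverseʳ : ∀ {x} → x ≢ 0# → x * x ⁻¹ ≡ 1#
  inverseʳ {x} x≢0 = *-cancelˡ (x ⁻¹) (⁻¹-nonzero x≢0) (begin
    x ⁻¹ * (x * x ⁻¹) ≡⟨ *-assoc _ _ _ ⟨
    x ⁻¹ * x * x ⁻¹   ≡⟨ cong (_* x ⁻¹) (inverseˡ x≢0) ⟩
    1# * x ⁻¹         ≡⟨ *-identityˡ _ ⟩
    x ⁻¹              ≡⟨ *-identityʳ _ ⟨
    x ⁻¹ * 1#         ∎)

  *-cancelʳ : ∀ x {y z} → x ≢ 0# → y * x ≡ z * x → y ≡ z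
  *-cancelʳ x {y} {z} x≢0 eq = begin
    y              ≡⟨ lemma y ⟨
    y * x * x ⁻¹ ≡⟨ cong (_* x ⁻¹) eq ⟩
    z * x * x ⁻¹ ≡⟨ lemma z ⟩
    z              ∎
    where
    lemma : ∀ w → w * x * x ⁻¹ ≡ w
    lemma w = trans (*-assoc _ _ _) (trans (cong (w *_) (inverseʳ x≢0)) (*-identityʳ w))

  ^-nonzero : ∀ {x} → x ≢ 0# → ∀ n → x ^ n ≢ 0#
  ^-nonzero x≢0 zero = 0≢1 ∘ sym
  ^-nonzero x≢0 (suc n) = *-nonzero x≢0 (^-nonzero x≢0 n)

  1^n≡1 : ∀ n → 1# ^ n ≡ 1#
  1^n≡1 zero = refl
  1^n≡1 (suc n) = trans (*-identityˡ _) (1^n≡1 n)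

  Commute : Fin m → Fin m → Set
  Commute x y = x * y ≡ y * x

  commute? : ∀ x y → Dec (Commute x y)
  commute? x y = x * y Fin.≟ y * x

  commute-+ : ∀ {x y z} → Commute x z → Commute y z → Commute (x + y) z
  commute-+ {x} {y} {z} xz yz = trans (distribʳ z x y) (trans (cong₂ _+_ xz yz) (sym (distribˡ z x y)))

  commute-* : ∀ {x y z} → Commute x z → Commute y z → Commute (x * y) z
  commute-* {x} {y} {z} xz yz = begin
    x * y * z   ≡⟨ *-assoc _ _ _ ⟩
    x * (y * z) ≡⟨ cong (x *_) yz ⟩
    x * (z * y) ≡⟨ *-assoc _ _ _ ⟨
    x * z * y   ≡⟨ cong (_* y) xz ⟩
    z * x * y   ≡⟨ *-assoc _ _ _ ⟩
    z * (x * y) ∎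

  commute-neg : ∀ {x z} → Commute x z → Commute (- x) z
  commute-neg {x} {z} xz = trans (sym (-‿distribˡ-* x z)) (trans (cong -_ xz) (-‿distribʳ-* z x))

  commute-⁻¹ : ∀ {x z} → x ≢ 0# → Commute x z → Commute (x ⁻¹) z
  commute-⁻¹ {x} {z} x≢0 xz = *-cancelˡ x x≢0 (*-cancelʳ x x≢0 (begin
    x * (x ⁻¹ * z) * x   ≡⟨ solve *-monoid ⟩
    (x * x ⁻¹) * (z * x) ≡⟨ cong₂ _*_ (inverseʳ x≢0) (sym xz) ⟩
    1# * (x * z)         ≡⟨ *-identityˡ _ ⟩
    x * z                ≡⟨ *-identityʳ _ ⟨
    x * z * 1#           ≡⟨ cong (x * z *_) (inverseˡ x≢0) ⟨
    x * z * (x ⁻¹ * x)   ≡⟨ solve *-monoid ⟩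
    x * (z * x ⁻¹) * x   ∎))

  commute-^ : ∀ {x z} n → Commute x z → Commute (x ^ n) z
  commute-^ zero xz = trans (*-identityˡ _) (sym (*-identityʳ _))
  commute-^ (suc n) xz = commute-* xz (commute-^ n xz)

  ^-distrib-* : ∀ {x y} → Commute x y → ∀ n → (x * y) ^ n ≡ x ^ n * y ^ n
  ^-distrib-* xy zero = sym (*-identityˡ _)
  ^-distrib-* {x} {y} xy (suc n) = begin
    x * y * (x * y) ^ n       ≡⟨ cong (x * y *_) (^-distrib-* xy n) ⟩
    x * y * (x ^ n * y ^ n)   ≡⟨ solve *-monoid ⟩
    x * (y * x ^ n) * y ^ n   ≡⟨ cong (λ w → x * w * y ^ n) (commute-^ n xy) ⟨
    x * (x ^ n * y) * y ^ n   ≡⟨ solve *-monoid ⟩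
    x * x ^ n * (y * y ^ n)   ∎

  -- m! works, since each order is at most m.
  unit-exponent : ∃ λ e → ∀ x → x ≢ 0# → x ^ suc e ≡ 1#
  unit-exponent = ℕ.pred (m ℕ.!) , λ x x≢0 →
    subst (λ e → x ^ e ≡ 1#) (sym (ℕ.suc-pred (m ℕ.!) {{m ℕ.!≢0}})) (x^m!≡1 x x≢0)
    where
    x^m!≡1 : ∀ x → x ≢ 0# → x ^ (m ℕ.!) ≡ 1#
    x^m!≡1 x x≢0 with Fin.pigeonhole (ℕ.n<1+n m) (λ i → x ^ toℕ i)
    ... | i , j , i<j , eq with d∣m!
      where
      d = toℕ j ℕ.∸ toℕ i
      d∣d! : ∀ d → 0 ℕ.< d → d ℕ.∣ d ℕ.!
      d∣d! (suc d) _ = ℕ.m∣m*n (d ℕ.!)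
      d∣m! : d ℕ.∣ m ℕ.!
      d∣m! = ℕ.∣-trans (d∣d! d (ℕ.m<n⇒0<n∸m i<j))
        (ℕ.m≤n⇒m!∣n! (ℕ.≤-trans (ℕ.m∸n≤m (toℕ j) (toℕ i)) (Fin.toℕ≤pred[n] j)))
    ... | ℕ.divides k m!≡k*d = begin
      x ^ (m ℕ.!)  ≡⟨ cong (x ^_) (trans m!≡k*d (ℕ.*-comm k d)) ⟩
      x ^ (d ℕ.* k) ≡⟨ ^-assocʳ x d k ⟨
      (x ^ d) ^ k   ≡⟨ cong (_^ k) x^d≡1 ⟩
      1# ^ k        ≡⟨ 1^n≡1 k ⟩
      1#            ∎
      where
      d = toℕ j ℕ.∸ toℕ i
      x^d≡1 : x ^ d ≡ 1#
      x^d≡1 = *-cancelˡ (x ^ toℕ i) (^-nonzero x≢0 (toℕ i)) (begin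
        x ^ toℕ i * x ^ d  ≡⟨ ^-homo-* x (toℕ i) d ⟨
        x ^ (toℕ i ℕ.+ d)  ≡⟨ cong (x ^_) (ℕ.m+[n∸m]≡n (ℕ.<⇒≤ i<j)) ⟩
        x ^ toℕ j          ≡⟨ eq ⟨
        x ^ toℕ i          ≡⟨ *-identityʳ _ ⟨
        x ^ toℕ i * 1#     ∎)

  sum-shift : ∀ (u : ℕ → Fin m) n →
              u 0 + sum {n} (λ i → u (suc (toℕ i))) ≡ sum {n} (λ i → u (toℕ i)) + u n
  sum-shift u zero = +-comm _ _
  sum-shift u (suc n) = trans (cong (u 0 +_) (sum-shift (u ∘ suc) n)) (sym (+-assoc _ _ _))

  -- The map T z = A z B satisfies T^h x = x, so the sum of the orbit of x is fixed by T. This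
  -- yields both the eigenvectors of conjugation by `a` and the intertwiners behind Hilbert 90.
  twisted-sum-fixed : ∀ h A B x → A ^ h * x * B ^ h ≡ x →
    let S = sum {h} (λ i → A ^ toℕ i * x * B ^ toℕ i) in A * S * B ≡ S
  twisted-sum-fixed h A B x wrap = begin
    A * S * B                             ≡⟨ cong (_* B) (*-distribˡ-sum {h} A (λ i → u (toℕ i))) ⟩
    sum {h} (λ i → A * u (toℕ i)) * B         ≡⟨ *-distribʳ-sum {h} B (λ i → A * u (toℕ i)) ⟩
    sum {h} (λ i → A * u (toℕ i) * B)         ≡⟨ sum-cong-≗ {h} (λ i → step (toℕ i)) ⟩
    -- Both sums differ from that of `u 0`, ..., `u h` by one end term, and `u h` equals `u 0`.
    sum {h} (λ i → u (suc (toℕ i)))       ≡⟨ +-cancelˡ (u 0) _ _ (begin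
      u 0 + sum {h} (λ i → u (suc (toℕ i))) ≡⟨ sum-shift u h ⟩
      S + u h                               ≡⟨ cong (S +_) (trans wrap (sym u₀)) ⟩
      S + u 0                               ≡⟨ +-comm _ _ ⟩
      u 0 + S                               ∎) ⟩
    S                                     ∎
    where
    u : ℕ → Fin m
    u i = A ^ i * x * B ^ i
    S = sum {h} (λ i → u (toℕ i))
    u₀ : u 0 ≡ x
    u₀ = trans (*-identityʳ _) (*-identityˡ x)
    step : ∀ i → A * u i * B ≡ u (suc i)
    step i = begin
      A * (A ^ i * x * B ^ i) * B   ≡⟨ solve *-monoid ⟩
      A * A ^ i * x * (B ^ i * B)   ≡⟨ cong (A * A ^ i * x *_) (commute-^ i refl) ⟩
      A * A ^ i * x * (B * B ^ i)   ∎

  -- Decidable membership inside `Fin m` allows sums over a subring and provides its size, the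
  -- measure of the induction in `subring-commutative`.
  record DivisionSubring : Set₁ where
    field
      Mem  : Fin m → Set
      mem? : Decidable Mem
      0∈   : Mem 0#
      1∈   : Mem 1#
      +∈   : ∀ {x y} → Mem x → Mem y → Mem (x + y)
      *∈   : ∀ {x y} → Mem x → Mem y → Mem (x * y)
      -∈   : ∀ {x} → Mem x → Mem (- x)
      ⁻¹∈  : ∀ {x} → x ≢ 0# → Mem x → Mem (x ⁻¹)

    ^∈ : ∀ {x} n → Mem x → Mem (x ^ n)
    ^∈ zero x∈ = 1∈
    ^∈ (suc n) x∈ = *∈ x∈ (^∈ n x∈)

    sum∈ : ∀ {n} (f : Fin n → Fin m) → (∀ i → Mem (f i)) → Mem (sum f)
    sum∈ {zero} f f∈ = 0∈
    sum∈ {suc n} f f∈ = +∈ (f∈ Fin.zero) (sum∈ (f ∘ Fin.suc) (f∈ ∘ Fin.suc))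

    Unit : Fin m → Set
    Unit x = Mem x × x ≢ 0#

    unit? : Decidable Unit
    unit? x = mem? x ×-dec ¬? (x Fin.≟ 0#)

    unit-* : ∀ {x y} → Unit x → Unit y → Unit (x * y)
    unit-* (x∈ , x≢0) (y∈ , y≢0) = *∈ x∈ y∈ , *-nonzero x≢0 y≢0

    unit-⁻¹ : ∀ {x} → Unit x → Unit (x ⁻¹)
    unit-⁻¹ (x∈ , x≢0) = ⁻¹∈ x≢0 x∈ , ⁻¹-nonzero x≢0

  whole : DivisionSubring
  whole = record
    { Mem = λ _ → ⊤ ; mem? = λ _ → yes tt }

  centralizer : DivisionSubring → Fin m → DivisionSubring
  centralizer P a = record
    { Mem = λ x → Mem x × Commute x a
    ; mem? = λ x → mem? x ×-dec commute? x a
    ; 0∈ = 0∈ , trans (zeroˡ a) (sym (zeroʳ a))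
    ; 1∈ = 1∈ , trans (*-identityˡ a) (sym (*-identityʳ a))
    ; +∈ = λ (x∈ , xa) (y∈ , ya) → +∈ x∈ y∈ , commute-+ xa ya
    ; *∈ = λ (x∈ , xa) (y∈ , ya) → *∈ x∈ y∈ , commute-* xa ya
    ; -∈ = λ (x∈ , xa) → -∈ x∈ , commute-neg xa
    ; ⁻¹∈ = λ x≢0 (x∈ , xa) → ⁻¹∈ x≢0 x∈ , commute-⁻¹ x≢0 xa
    }
    where open DivisionSubring P

-- Character sums over a finite division subring

module CharacterSums {m : ℕ} (D : FiniteDivisionRing m) (K : DivisionRingProperties.DivisionSubring D) where
  open DivisionRingProperties D
  open Ring ring hiding (refl; sym; trans; reflexive; isRing)
  open import Algebra.Properties.Ring ring
  open import Algebra.Properties.Semiring.Sum semiring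
  open ≡-Reasoning
  open DivisionSubring K

  only : {P : Set} → Dec P → Fin m → Fin m
  only P? x = choose P? x 0#

  only-cong : ∀ {P : Set} (P? : Dec P) {x y} → (P → x ≡ y) → only P? x ≡ only P? y
  only-cong (yes p) eq = eq p
  only-cong (no _)  eq = refl

  only-⇔ : ∀ {P Q : Set} (P? : Dec P) (Q? : Dec Q) → (P → Q) → (Q → P) → ∀ x → only P? x ≡ only Q? x
  only-⇔ (yes p) (yes q) P⇒Q Q⇒P x = refl
  only-⇔ (yes p) (no ¬q) P⇒Q Q⇒P x = contradiction (P⇒Q p) ¬q
  only-⇔ (no ¬p) (yes q) P⇒Q Q⇒P x = contradiction (Q⇒P q) ¬p
  only-⇔ (no ¬p) (no ¬q) P⇒Q Q⇒P x = refl

  only-*ˡ : ∀ {P : Set} (P? : Dec P) c x → c * only P? x ≡ only P? (c * x)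
  only-*ˡ (yes _) c x = refl
  only-*ˡ (no _)  c x = zeroʳ c

  only-*ʳ : ∀ {P : Set} (P? : Dec P) c x → only P? x * c ≡ only P? (x * c)
  only-*ʳ (yes _) c x = refl
  only-*ʳ (no _)  c x = zeroˡ c

  only-sum : ∀ {P : Set} (P? : Dec P) {n} (f : Fin n → Fin m) → only P? (sum f) ≡ sum (λ i → only P? (f i))
  only-sum (yes _) f = refl
  only-sum (no _) {n} f = sym (sum-replicate-zero n)

  -- A sum over the units of `K`, extended by zeros to the whole ring, so that translation by a unit
  -- permutes the entire index set.
  ∑* : (Fin m → Fin m) → Fin m
  ∑* f = sum (λ k → only (unit? k) (f k))

  ∑*-cong : ∀ {f g} → (∀ k → Unit k → f k ≡ g k) → ∑* f ≡ ∑* g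
  ∑*-cong f≡g = sum-cong-≗ (λ k → only-cong (unit? k) (f≡g k))

  ∑*-distribˡ : ∀ c f → c * ∑* f ≡ ∑* (λ k → c * f k)
  ∑*-distribˡ c f = trans (*-distribˡ-sum c (λ k → only (unit? k) (f k))) (sum-cong-≗ (λ k → only-*ˡ (unit? k) c (f k)))

  ∑*-distribʳ : ∀ c f → ∑* f * c ≡ ∑* (λ k → f k * c)
  ∑*-distribʳ c f = trans (*-distribʳ-sum c (λ k → only (unit? k) (f k))) (sum-cong-≗ (λ k → only-*ʳ (unit? k) c (f k)))

  ∑*-sum : ∀ {n} (f : Fin m → Fin n → Fin m) → ∑* (λ k → sum (f k)) ≡ sum (λ i → ∑* (λ k → f k i))
  ∑*-sum f = trans (sum-cong-≗ (λ k → only-sum (unit? k) (f k))) (∑-comm (λ k i → only (unit? k) (f k i)))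

  ∑*-zero : ∀ {f} → (∀ k → Unit k → f k ≡ 0#) → ∑* f ≡ 0#
  ∑*-zero f≡0 = trans (sum-cong-≗ (λ k → zeroed (unit? k) (f≡0 k))) (sum-replicate-zero m)
    where
    zeroed : ∀ {P : Set} (P? : Dec P) {x} → (P → x ≡ 0#) → only P? x ≡ 0#
    zeroed (yes p) eq = eq p
    zeroed (no _)  eq = refl

  ∑*∈ : ∀ {f} → (L : DivisionSubring) → (∀ k → Unit k → DivisionSubring.Mem L (f k)) → DivisionSubring.Mem L (∑* f)
  ∑*∈ L f∈ = DivisionSubring.sum∈ L _ (λ k → lemma (unit? k) (f∈ k))
    where
    lemma : ∀ {P : Set} (P? : Dec P) {x} → (P → DivisionSubring.Mem L x) → DivisionSubring.Mem L (only P? x)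
    lemma (yes p) x∈ = x∈ p
    lemma (no _)  x∈ = DivisionSubring.0∈ L

  cancel-unitˡ : ∀ {g k} → Unit g → Unit (g * k) → Unit k
  cancel-unitˡ {g} {k} ug u = subst Unit (begin
    g ⁻¹ * (g * k) ≡⟨ *-assoc _ _ _ ⟨
    g ⁻¹ * g * k   ≡⟨ cong (_* k) (inverseˡ (proj₂ ug)) ⟩
    1# * k         ≡⟨ *-identityˡ k ⟩
    k              ∎) (unit-* (unit-⁻¹ ug) u)

  ∑*-translate : ∀ {g} f → Unit g → ∑* f ≡ ∑* (λ k → f (g * k))
  ∑*-translate {g} f ug@(_ , g≢0) = trans
    (sum-permute (λ k → only (unit? k) (f k)) (permutation (g *_) (g ⁻¹ *_) left right))
    (sum-cong-≗ (λ k → only-⇔ (unit? (g * k)) (unit? k) (cancel-unitˡ ug) (unit-* ug) (f (g * k))))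
    where
    left : ∀ k → g * (g ⁻¹ * k) ≡ k
    left k = trans (sym (*-assoc _ _ _)) (trans (cong (_* k) (inverseʳ g≢0)) (*-identityˡ k))
    right : ∀ k → g ⁻¹ * (g * k) ≡ k
    right k = trans (sym (*-assoc _ _ _)) (trans (cong (_* k) (inverseˡ g≢0)) (*-identityˡ k))

  -- Translation by `g` preserves the sum and multiplies it by χ g, so the nonzero element χ g - 1
  -- annihilates it.
  ∑*-nontrivial : ∀ {g} χ → Unit g → (∀ k → Unit k → χ (g * k) ≡ χ g * χ k) → χ g ≢ 1# → ∑* χ ≡ 0#
  ∑*-nontrivial {g} χ ug hom χg≢1 = *-cancelˡ (χ g + - 1#) χg-1≢0 (begin
    (χ g + - 1#) * ∑* χ        ≡⟨ distribʳ (∑* χ) (χ g) (- 1#) ⟩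
    χ g * ∑* χ + - 1# * ∑* χ   ≡⟨ cong₂ _+_ fixed (-1*x≈-x (∑* χ)) ⟩
    ∑* χ + - ∑* χ              ≡⟨ -‿inverseʳ (∑* χ) ⟩
    0#                         ≡⟨ zeroʳ _ ⟨
    (χ g + - 1#) * 0#          ∎)
    where
    χg-1≢0 : χ g + - 1# ≢ 0#
    χg-1≢0 eq = χg≢1 (trans (+-inverseˡ-unique (χ g) (- 1#) eq) (-‿involutive 1#))
    fixed : χ g * ∑* χ ≡ ∑* χ
    fixed = begin
      χ g * ∑* χ              ≡⟨ ∑*-distribˡ (χ g) χ ⟩
      ∑* (λ k → χ g * χ k)    ≡⟨ ∑*-cong (λ k uk → sym (hom k uk)) ⟩
      ∑* (λ k → χ (g * k))    ≡⟨ ∑*-translate χ ug ⟨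
      ∑* χ                    ∎

  -- |K| = 0 in D: translating by 1 leaves Σ_{k ∈ K} k unchanged and adds |K| to it.
  sum-of-ones : sum (λ k → only (mem? k) 1#) ≡ 0#
  sum-of-ones = +-cancelˡ total _ _ (begin
    total + sum (λ k → only (mem? k) 1#)                        ≡⟨ ∑-distrib-+ (λ k → only (mem? k) k) (λ k → only (mem? k) 1#) ⟨
    sum (λ k → only (mem? k) k + only (mem? k) 1#)              ≡⟨ sum-cong-≗ (λ k → absorb (mem? k) k) ⟩
    sum (λ k → only (mem? k) (k + 1#))                          ≡⟨ sum-cong-≗ (λ k → only-⇔ (mem? k) (mem? (k + 1#)) (λ k∈ → +∈ k∈ 1∈) (back k) (k + 1#)) ⟩
    sum (λ k → only (mem? (k + 1#)) (k + 1#))                   ≡⟨ sum-permute (λ k → only (mem? k) k) (permutation (_+ 1#) (_+ - 1#) left right) ⟨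
    total                                                       ≡⟨ +-identityʳ total ⟨
    total + 0#                                                  ∎)
    where
    total = sum (λ k → only (mem? k) k)
    left : ∀ k → k + - 1# + 1# ≡ k
    left k = trans (+-assoc _ _ _) (trans (cong (k +_) (-‿inverseˡ 1#)) (+-identityʳ k))
    right : ∀ k → k + 1# + - 1# ≡ k
    right k = trans (+-assoc _ _ _) (trans (cong (k +_) (-‿inverseʳ 1#)) (+-identityʳ k))
    back : ∀ k → Mem (k + 1#) → Mem k
    back k k+1∈ = subst Mem (right k) (+∈ k+1∈ (-∈ 1∈))
    absorb : ∀ {P : Set} (P? : Dec P) k → only P? k + only P? 1# ≡ only P? (k + 1#)
    absorb (yes _) k = refl
    absorb (no _) k = +-identityˡ 0#

  -- The units are `K` without 0, and |K| = 0 by `sum-of-ones`.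
  ∑*-ones : ∑* (λ _ → 1#) ≡ - 1#
  ∑*-ones = +-cancelʳ 1# _ _ (begin
    ∑* (λ _ → 1#) + 1#                                              ≡⟨ cong (∑* (λ _ → 1#) +_) δ-sum ⟨
    ∑* (λ _ → 1#) + sum (λ k → only (k Fin.≟ 0#) 1#)                ≡⟨ ∑-distrib-+ (λ k → only (unit? k) 1#) (λ k → only (k Fin.≟ 0#) 1#) ⟨
    sum (λ k → only (unit? k) 1# + only (k Fin.≟ 0#) 1#)            ≡⟨ sum-cong-≗ split ⟩
    sum (λ k → only (mem? k) 1#)                                    ≡⟨ sum-of-ones ⟩
    0#                                                              ≡⟨ -‿inverseˡ 1# ⟨
    - 1# + 1#                                                       ∎)
    where
    δ : ∀ {n} (j : Fin n) → sum (λ k → only (k Fin.≟ j) 1#) ≡ 1#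
    δ {suc n} Fin.zero = trans (cong (1# +_) (sum-replicate-zero n)) (+-identityʳ 1#)
    δ {suc n} (Fin.suc j) = trans (+-identityˡ _)
      (trans (sum-cong-≗ (λ k → only-⇔ (Fin.suc k Fin.≟ Fin.suc j) (k Fin.≟ j) Fin.suc-injective (cong Fin.suc) 1#)) (δ j))
    δ-sum : sum (λ k → only (k Fin.≟ 0#) 1#) ≡ 1#
    δ-sum = δ 0#
    split : ∀ k → only (unit? k) 1# + only (k Fin.≟ 0#) 1# ≡ only (mem? k) 1#
    split k with unit? k | k Fin.≟ 0# | mem? k
    ... | yes (_ , k≢0) | yes k≡0 | _       = contradiction k≡0 k≢0
    ... | yes _         | no _    | yes _   = +-identityʳ 1#
    ... | yes (k∈ , _)  | no _    | no k∉   = contradiction k∈ k∉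
    ... | no _          | yes _   | yes _   = +-identityˡ 1#
    ... | no _          | yes k≡0 | no k∉   = contradiction (subst Mem (sym k≡0) 0∈) k∉
    ... | no ¬u         | no k≢0  | yes k∈  = contradiction (k∈ , k≢0) ¬u
    ... | no _          | no _    | no _    = +-identityˡ 0#

  record Nontrivial (χ : Fin m → Fin m) : Set where
    constructor nontrivial
    field
      at       : Fin m
      unit     : Unit at
      hom      : ∀ k → Unit k → χ (at * k) ≡ χ at * χ k
      moves    : χ at ≢ 1#

  -- Exchanging the sums puts a character sum in front of each `w i`: -1 for the trivial character,
  -- 0 for the others.
  orthogonality : ∀ {t} (χ : Fin (suc t) → Fin m → Fin m) (w : Fin (suc t) → Fin m) →
    (∀ k → Unit k → χ Fin.zero k ≡ 1#) → (∀ i → Nontrivial (χ (Fin.suc i))) →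
    ∑* (λ k → sum (λ i → χ i k * w i)) ≡ - w Fin.zero
  orthogonality {t} χ w trivial nontriv = begin
    ∑* (λ k → sum (λ i → χ i k * w i))   ≡⟨ ∑*-sum (λ k i → χ i k * w i) ⟩
    sum (λ i → ∑* (λ k → χ i k * w i))   ≡⟨ sum-cong-≗ (λ i → sym (∑*-distribʳ (w i) (χ i))) ⟩
    sum (λ i → ∑* (χ i) * w i)           ≡⟨ cong₂ _+_ head tail ⟩
    - w Fin.zero + 0#                    ≡⟨ +-identityʳ _ ⟩
    - w Fin.zero                         ∎
    where
    head : ∑* (χ Fin.zero) * w Fin.zero ≡ - w Fin.zero
    head = trans (cong (_* w Fin.zero) (trans (∑*-cong trivial) ∑*-ones)) (-1*x≈-x _)
    tail : sum (λ i → ∑* (χ (Fin.suc i)) * w (Fin.suc i)) ≡ 0#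
    tail = trans (sum-cong-≗ λ i → let open Nontrivial (nontriv i) in
      trans (cong (_* w (Fin.suc i)) (∑*-nontrivial (χ (Fin.suc i)) unit hom moves)) (zeroˡ _)) (sum-replicate-zero t)

-- Wedderburn's theorem

module Conjugation {m : ℕ} (D : FiniteDivisionRing m) where
  open DivisionRingProperties D
  open Ring ring hiding (refl; sym; trans; reflexive; isRing)
  open import Algebra.Properties.Semiring.Exp semiring
  open ≡-Reasoning

  ⁻¹-unique : ∀ {x y} → x ≢ 0# → x * y ≡ 1# → y ≡ x ⁻¹
  ⁻¹-unique {x} x≢0 xy≡1 = *-cancelˡ x x≢0 (trans xy≡1 (sym (inverseʳ x≢0)))

  ⁻¹-* : ∀ {x y} → x ≢ 0# → y ≢ 0# → (x * y) ⁻¹ ≡ y ⁻¹ * x ⁻¹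
  ⁻¹-* {x} {y} x≢0 y≢0 = sym (⁻¹-unique (*-nonzero x≢0 y≢0) (begin
    x * y * (y ⁻¹ * x ⁻¹) ≡⟨ solve *-monoid ⟩
    x * (y * y ⁻¹) * x ⁻¹ ≡⟨ cong (λ w → x * w * x ⁻¹) (inverseʳ y≢0) ⟩
    x * 1# * x ⁻¹         ≡⟨ cong (_* x ⁻¹) (*-identityʳ x) ⟩
    x * x ⁻¹              ≡⟨ inverseʳ x≢0 ⟩
    1#                    ∎))

  1≢0 : 1# ≢ 0#
  1≢0 = FiniteDivisionRing.0≢1 D ∘ sym

  1⁻¹≡1 : 1# ⁻¹ ≡ 1#
  1⁻¹≡1 = sym (⁻¹-unique 1≢0 (*-identityʳ 1#))

  ⁻¹-^ : ∀ {x} → x ≢ 0# → ∀ n → (x ⁻¹) ^ n ≡ (x ^ n) ⁻¹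
  ⁻¹-^ x≢0 zero = sym 1⁻¹≡1
  ⁻¹-^ {x} x≢0 (suc n) = begin
    x ⁻¹ * (x ⁻¹) ^ n ≡⟨ commute-^ n refl ⟨
    (x ⁻¹) ^ n * x ⁻¹ ≡⟨ cong (_* x ⁻¹) (⁻¹-^ x≢0 n) ⟩
    (x ^ n) ⁻¹ * x ⁻¹ ≡⟨ ⁻¹-* x≢0 (^-nonzero x≢0 n) ⟨
    (x * x ^ n) ⁻¹    ∎

  cancel-innerˡ : ∀ {x} → x ≢ 0# → ∀ y z → y * x ⁻¹ * (x * z) ≡ y * z
  cancel-innerˡ {x} x≢0 y z = begin
    y * x ⁻¹ * (x * z)   ≡⟨ solve *-monoid ⟩
    y * (x ⁻¹ * x) * z   ≡⟨ cong (λ w → y * w * z) (inverseˡ x≢0) ⟩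
    y * 1# * z           ≡⟨ solve *-monoid ⟩
    y * z                ∎

  cancel-lastʳ : ∀ {x} → x ≢ 0# → ∀ y → y * x ⁻¹ * x ≡ y
  cancel-lastʳ {x} x≢0 y = trans (*-assoc _ _ _) (trans (cong (y *_) (inverseˡ x≢0)) (*-identityʳ y))

  *-regroup : ∀ p q r s → p * q * (r * s) ≡ p * (q * r) * s
  *-regroup p q r s = solve *-monoid

  conj : Fin m → Fin m → Fin m
  conj y k = y * k * y ⁻¹

  conj-* : ∀ {y} → y ≢ 0# → ∀ k l → conj y (k * l) ≡ conj y k * conj y l
  conj-* {y} y≢0 k l = begin
    y * (k * l) * y ⁻¹              ≡⟨ solve *-monoid ⟩
    y * k * (l * y ⁻¹)              ≡⟨ cancel-innerˡ y≢0 (y * k) (l * y ⁻¹) ⟨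
    y * k * y ⁻¹ * (y * (l * y ⁻¹)) ≡⟨ solve *-monoid ⟩
    y * k * y ⁻¹ * (y * l * y ⁻¹)   ∎

  conj-∘ : ∀ {y z} → y ≢ 0# → z ≢ 0# → ∀ k → conj (y * z) k ≡ conj y (conj z k)
  conj-∘ {y} {z} y≢0 z≢0 k = begin
    y * z * k * (y * z) ⁻¹      ≡⟨ cong (y * z * k *_) (⁻¹-* y≢0 z≢0) ⟩
    y * z * k * (z ⁻¹ * y ⁻¹)   ≡⟨ solve *-monoid ⟩
    y * (z * k * z ⁻¹) * y ⁻¹   ∎

  conj-swap : ∀ {y} → y ≢ 0# → ∀ k → y * k ≡ conj y k * y
  conj-swap y≢0 k = sym (cancel-lastʳ y≢0 _)

  conj-1 : ∀ k → conj 1# k ≡ k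
  conj-1 k = trans (cong₂ _*_ (*-identityˡ k) 1⁻¹≡1) (*-identityʳ k)

  conj-fixed : ∀ {y k} → y ≢ 0# → Commute y k → conj y k ≡ k
  conj-fixed {y} {k} y≢0 yk = begin
    y * k * y ⁻¹   ≡⟨ cong (_* y ⁻¹) yk ⟩
    k * y * y ⁻¹   ≡⟨ *-assoc _ _ _ ⟩
    k * (y * y ⁻¹) ≡⟨ cong (k *_) (inverseʳ y≢0) ⟩
    k * 1#         ≡⟨ *-identityʳ k ⟩
    k              ∎

  conj-commute : ∀ {y k l} → y ≢ 0# → Commute k l → Commute (conj y k) (conj y l)
  conj-commute {y} {k} {l} y≢0 kl =
    trans (sym (conj-* y≢0 k l)) (trans (cong (conj y) kl) (conj-* y≢0 l k))

  conj-nonzero : ∀ {y k} → y ≢ 0# → k ≢ 0# → conj y k ≢ 0#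
  conj-nonzero y≢0 k≢0 = *-nonzero (*-nonzero y≢0 k≢0) (⁻¹-nonzero y≢0)

  conj-injective : ∀ {y k l} → y ≢ 0# → conj y k ≡ conj y l → k ≡ l
  conj-injective y≢0 eq = *-cancelˡ _ y≢0 (*-cancelʳ _ (⁻¹-nonzero y≢0) eq)

  commute-nonzero : ∀ {x y} → ¬ Commute x y → x ≢ 0#
  commute-nonzero {y = y} ¬xy refl = ¬xy (trans (zeroˡ y) (sym (zeroʳ y)))

  -- A witness that depends on the predicate alone. Hence `R` and `L` depend only on a value of `ν`
  -- or `β`, not on the element that produced it, as the injectivity of `f` requires. The default is
  -- returned only when there is no witness.
  section : {Q : Fin m → Set} → Decidable Q → Fin m
  section Q? with Fin.any? Q?
  ... | yes (z , _) = z
  ... | no _ = 1#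

  section-correct : {Q : Fin m → Set} (Q? : Decidable Q) → ∀ {z} → Q z → Q (section Q?)
  section-correct Q? {z} q with Fin.any? Q?
  ... | yes (_ , q′) = q′
  ... | no none = contradiction (z , q) none

-- A minimal noncommutative division subring

module MinimalNoncommutative {m : ℕ} (D : FiniteDivisionRing m) (P : DivisionRingProperties.DivisionSubring D) where
  open DivisionRingProperties D
  open Ring ring hiding (refl; sym; trans; reflexive; isRing)
  open import Algebra.Properties.Ring ring
  open import Algebra.Properties.Semiring.Sum semiring
  open import Algebra.Properties.Semiring.Exp semiring
  open Conjugation D
  open ≡-Reasoning

  private module P = DivisionSubring P

  module Contradiction
    -- What minimality of `P` provides: the centralizer in `P` of a noncentral `c` is commutative,
    -- with `d` as witness that `c` is not central.
    (centralizers-commutative : ∀ {c d x y} → P.Mem c → P.Mem d → P.Mem x → P.Mem y →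
                                ¬ Commute c d → Commute x c → Commute y c → Commute x y)
    {a b : Fin m} (a∈P : P.Mem a) (b∈P : P.Mem b) (a≁b : ¬ Commute a b)
    where

    K : DivisionSubring
    K = centralizer P a

    open DivisionSubring K
    open CharacterSums D K

    K-commutative : ∀ {x y} → Mem x → Mem y → Commute x y
    K-commutative (x∈ , xa) (y∈ , ya) = centralizers-commutative a∈P b∈P x∈ y∈ a≁b xa ya

    a≢0 : a ≢ 0#
    a≢0 = commute-nonzero a≁b

    unit-a : Unit a
    unit-a = (a∈P , refl) , a≢0

    -- Only the image of `a` is tested; that all of `K` is carried into itself follows in `τ∈`.
    Normalizing : Fin m → Set
    Normalizing y = P.Mem y × ¬ Commute y a × Mem (conj y a)

    normalizing? : Decidable Normalizing
    normalizing? y = P.mem? y ×-dec ¬? (commute? y a) ×-dec mem? (conj y a)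

    -- The operators x ↦ Σ_j (κ a)^j x a^{-j} project onto the eigenspaces of conjugation by a.
    -- If no element normalizes K nontrivially, each of them maps b into K; but they sum to −b.
    normalizing : ∃ Normalizing
    normalizing = decidable-stable (Fin.any? normalizing?) λ none → a≁b (sym (proj₂ (b∈K none)))
      where
      module _ (none : ¬ ∃ Normalizing) where
        KillsUnits : ℕ → Set
        KillsUnits j = ∀ k → Unit k → k ^ suc j ≡ 1#
        killsUnits? : Decidable KillsUnits
        killsUnits? j = Fin.all? (λ k → unit? k →-dec k ^ suc j Fin.≟ 1#)
        -- Minimality of the exponent `h` of K* makes k ↦ k^i a nontrivial character for 0 < i < h.
        exponent = least killsUnits? (proj₁ unit-exponent) (λ k uk → proj₂ unit-exponent k (proj₂ uk))
        h-1 = proj₁ exponent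
        h = suc h-1
        eigen : Fin m → Fin m
        eigen κ = sum {h} (λ i → (κ * a) ^ toℕ i * b * (a ⁻¹) ^ toℕ i)
        eigen-fixed : ∀ {κ} → Unit κ → κ * a * eigen κ * a ⁻¹ ≡ eigen κ
        eigen-fixed {κ} uκ = twisted-sum-fixed h (κ * a) (a ⁻¹) b (begin
          (κ * a) ^ h * b * (a ⁻¹) ^ h ≡⟨ cong₂ (λ u v → u * b * v) (kills _ (unit-* uκ unit-a)) (kills _ (unit-⁻¹ unit-a)) ⟩
          1# * b * 1#                  ≡⟨ solve *-monoid ⟩
          b                            ∎)
          where kills = proj₁ (proj₂ exponent)
        eigen∈P : ∀ {κ} → Unit κ → P.Mem (eigen κ)
        eigen∈P uκ = P.sum∈ {h} _ (λ i → P.*∈ (P.*∈ (P.^∈ (toℕ i) (proj₁ (proj₁ (unit-* uκ unit-a)))) b∈P)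
                                             (P.^∈ (toℕ i) (proj₁ (proj₁ (unit-⁻¹ unit-a)))))
        -- An eigenvector S satisfies S a = κ a S, so a nonzero one conjugates `a` into `K`; unless
        -- it commutes with `a`, it is a normalizing element.
        conj-eigen : ∀ {κ} → Unit κ → eigen κ ≢ 0# → conj (eigen κ) a ≡ κ * a
        conj-eigen {κ} uκ S≢0 = *-cancelʳ (eigen κ) S≢0 (begin
          eigen κ * a * eigen κ ⁻¹ * eigen κ ≡⟨ cancel-lastʳ S≢0 (eigen κ * a) ⟩
          eigen κ * a                        ≡⟨ cong (_* a) (eigen-fixed uκ) ⟨
          κ * a * eigen κ * a ⁻¹ * a         ≡⟨ cancel-lastʳ a≢0 _ ⟩
          κ * a * eigen κ                    ∎)
        eigen∈K : ∀ κ → Unit κ → Mem (eigen κ)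
        eigen∈K κ uκ = helper (eigen κ Fin.≟ 0#)
          where
          helper : Dec (eigen κ ≡ 0#) → Mem (eigen κ)
          helper (yes S≡0) = subst Mem (sym S≡0) 0∈
          helper (no S≢0) = eigen∈P uκ , decidable-stable (commute? (eigen κ) a) (λ ≁ →
                none (eigen κ , eigen∈P uκ , ≁ , subst Mem (sym (conj-eigen uκ S≢0)) (proj₁ (unit-* uκ unit-a))))
        nontriv : ∀ i → Nontrivial (λ k → k ^ toℕ (Fin.suc {h-1} i))
        nontriv i =
          let j = toℕ i
              g , ¬ok = Fin.¬∀⟶∃¬ m _ (λ k → unit? k →-dec k ^ suc j Fin.≟ 1#) (proj₂ (proj₂ exponent) j (Fin.toℕ<n i))
              ug = decidable-stable (unit? g) (λ ¬ug → ¬ok (λ ug → contradiction ug ¬ug))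
          in nontrivial g ug
               (λ k uk → ^-distrib-* (K-commutative (proj₁ ug) (proj₁ uk)) (suc j))
               (λ eq → ¬ok (λ _ → eq))
        total : ∑* eigen ≡ - b
        total = begin
          ∑* eigen                                             ≡⟨ ∑*-cong (λ κ uκ → sum-cong-≗ {h} (λ i → factor κ uκ (toℕ i))) ⟩
          ∑* (λ κ → sum {h} (λ i → κ ^ toℕ i * (a ^ toℕ i * b * (a ⁻¹) ^ toℕ i)))
            ≡⟨ orthogonality (λ i κ → κ ^ toℕ i) (λ i → a ^ toℕ i * b * (a ⁻¹) ^ toℕ i) (λ _ _ → refl) nontriv ⟩
          - (1# * b * 1#)                                      ≡⟨ cong -_ (trans (*-identityʳ _) (*-identityˡ b)) ⟩
          - b                                                  ∎
          where
          factor : ∀ κ → Unit κ → ∀ i → (κ * a) ^ i * b * (a ⁻¹) ^ i ≡ κ ^ i * (a ^ i * b * (a ⁻¹) ^ i)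
          factor κ uκ i = begin
            (κ * a) ^ i * b * (a ⁻¹) ^ i      ≡⟨ cong (λ w → w * b * (a ⁻¹) ^ i) (^-distrib-* (proj₂ (proj₁ uκ)) i) ⟩
            κ ^ i * a ^ i * b * (a ⁻¹) ^ i    ≡⟨ solve *-monoid ⟩
            κ ^ i * (a ^ i * b * (a ⁻¹) ^ i)  ∎
        b∈K : Mem b
        b∈K = subst Mem (trans (cong -_ total) (-‿involutive b)) (-∈ (∑*∈ K eigen∈K))

    x : Fin m
    x = proj₁ normalizing

    x∈P : P.Mem x
    x∈P = proj₁ (proj₂ normalizing)

    x≁a : ¬ Commute x a
    x≁a = proj₁ (proj₂ (proj₂ normalizing))

    x≢0 : x ≢ 0#
    x≢0 = commute-nonzero x≁a

    τ : Fin m → Fin m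
    τ = conj x

    -- Both τ k and `a` commute with τ a, the latter because τ a lies in `K`. As τ a does not
    -- commute with τ b, its centralizer is commutative, so τ k commutes with `a`.
    τ∈ : ∀ {k} → Mem k → Mem (τ k)
    τ∈ {k} (k∈ , ka) = τ∈P k∈ , centralizers-commutative (τ∈P a∈P) (τ∈P b∈P) (τ∈P k∈) a∈P
        (λ comm → a≁b (conj-injective x≢0 (trans (conj-* x≢0 a b) (trans comm (sym (conj-* x≢0 b a))))))
        (conj-commute x≢0 ka) (sym (proj₂ (proj₂ (proj₂ (proj₂ normalizing)))))
      where
      τ∈P : ∀ {k} → P.Mem k → P.Mem (τ k)
      τ∈P k∈ = P.*∈ (P.*∈ x∈P k∈) (P.⁻¹∈ x≢0 x∈P)

    τ-unit : ∀ {k} → Unit k → Unit (τ k)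
    τ-unit (k∈ , k≢0) = τ∈ k∈ , conj-nonzero x≢0 k≢0

    -- Were `k` not central in `P`, its centralizer would be commutative, yet it contains `y` and
    -- `a`.
    central : ∀ {k y} → Mem k → P.Mem y → ¬ Commute y a → Commute y k → ∀ {d} → P.Mem d → Commute k d
    central {k} (k∈ , ka) y∈ y≁a yk {d} d∈ = decidable-stable (commute? k d)
      (λ k≁d → y≁a (centralizers-commutative k∈ d∈ y∈ a∈P k≁d yk (sym ka)))

    period : ∃ λ t-1 → Mem (x ^ suc t-1) × (∀ j → j ℕ.< t-1 → ¬ Mem (x ^ suc j))
    period = least (λ j → mem? (x ^ suc j)) (proj₁ unit-exponent)
      (subst Mem (sym (proj₂ unit-exponent x x≢0)) 1∈)

    t-1 t : ℕ
    t-1 = proj₁ period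
    t = suc t-1

    x^-normalizes : ∀ i {k} → Mem k → Mem (conj (x ^ i) k)
    x^-normalizes zero k∈ = subst Mem (sym (conj-1 _)) k∈
    x^-normalizes (suc i) k∈ = subst Mem (sym (conj-∘ x≢0 (^-nonzero x≢0 i) _)) (τ∈ (x^-normalizes i k∈))

    -- Moving every x to the right past elements of `K` applies τ to them; c is the partial norm k
    -- τ(k) ⋯ τ^(i-1)(k).
    power-form : ∀ {k} → Unit k → ∀ i → ∃ λ c → Unit c × (k * x) ^ i ≡ c * x ^ i
    power-form uk zero = 1# , (1∈ , 1≢0) , sym (*-identityˡ _)
    power-form {k} uk (suc i) =
      let c , uc , eq = power-form uk i in
      k * τ c , unit-* uk (τ-unit uc) , (begin
        k * x * (k * x) ^ i   ≡⟨ cong (k * x *_) eq ⟩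
        k * x * (c * x ^ i)   ≡⟨ *-regroup k x c (x ^ i) ⟩
        k * (x * c) * x ^ i   ≡⟨ cong (λ w → k * w * x ^ i) (conj-swap x≢0 c) ⟩
        k * (τ c * x) * x ^ i ≡⟨ *-regroup k (τ c) x (x ^ i) ⟨
        k * τ c * (x * x ^ i) ∎)

    -- Up to the constant factor x^t this is the norm k τ(k) ⋯ τ^(t-1)(k). Written as a power it
    -- visibly commutes with k x, which makes it central in `P`.
    ν : Fin m → Fin m
    ν k = (k * x) ^ t

    module _ {k : Fin m} (uk : Unit k) where
      y : Fin m
      y = k * x

      y∈P : P.Mem y
      y∈P = P.*∈ (proj₁ (proj₁ uk)) x∈P

      y≢0 : y ≢ 0#
      y≢0 = *-nonzero (proj₂ uk) x≢0

      y≁a : ¬ Commute y a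
      y≁a ya = x≁a (*-cancelˡ k (proj₂ uk) (begin
        k * (x * a) ≡⟨ *-assoc _ _ _ ⟨
        k * x * a   ≡⟨ ya ⟩
        a * (k * x) ≡⟨ *-assoc _ _ _ ⟨
        a * k * x   ≡⟨ cong (_* x) (proj₂ (proj₁ uk)) ⟨
        k * a * x   ≡⟨ *-assoc _ _ _ ⟩
        k * (a * x) ∎))

      ν-unit : Unit (ν k)
      ν-unit = let c , uc , eq = power-form uk t in
        subst Unit (sym eq) (unit-* uc (proj₁ (proj₂ period) , ^-nonzero x≢0 t))

      ν-central : ∀ {d} → P.Mem d → Commute (ν k) d
      ν-central = central (proj₁ ν-unit) y∈P y≁a (sym (commute-^ t refl))

      y^-normalizes : ∀ i {c} → Mem c → Mem (conj (y ^ i) c)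
      y^-normalizes i {c} c∈ = let e , ue , eq = power-form uk i in
        subst Mem (sym (trans (cong (λ w → conj w c) eq) (conj-∘ (proj₂ ue) (^-nonzero x≢0 i) c)))
              (*∈ (*∈ (proj₁ ue) (x^-normalizes i c∈)) (proj₁ (unit-⁻¹ ue)))

      y^∉K : ∀ i → i ℕ.< t-1 → ¬ Mem (y ^ suc i)
      y^∉K i i<t y^∈ = let e , ue , eq = power-form uk (suc i) in
        proj₂ (proj₂ period) i i<t (subst Mem (begin
        e ⁻¹ * y ^ suc i         ≡⟨ cong (e ⁻¹ *_) eq ⟩
        e ⁻¹ * (e * x ^ suc i)   ≡⟨ *-assoc _ _ _ ⟨
        e ⁻¹ * e * x ^ suc i     ≡⟨ cong (_* x ^ suc i) (inverseˡ (proj₂ ue)) ⟩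
        1# * x ^ suc i           ≡⟨ *-identityˡ _ ⟩
        x ^ suc i                ∎) (*∈ (proj₁ (unit-⁻¹ ue)) y^∈))

      χ : Fin t → Fin m → Fin m
      χ i c = c ⁻¹ * conj (y ^ toℕ i) c

      χ-nontrivial : ∀ i → Nontrivial (χ (Fin.suc i))
      χ-nontrivial i = nontrivial a unit-a hom moves
        where
        n = suc (toℕ i)
        φ = conj (y ^ n)
        hom : ∀ c → Unit c → (a * c) ⁻¹ * φ (a * c) ≡ a ⁻¹ * φ a * (c ⁻¹ * φ c)
        hom c uc = begin
          (a * c) ⁻¹ * φ (a * c)       ≡⟨ cong₂ _*_ (⁻¹-* a≢0 (proj₂ uc)) (conj-* (^-nonzero y≢0 n) a c) ⟩
          c ⁻¹ * a ⁻¹ * (φ a * φ c)    ≡⟨ *-regroup (c ⁻¹) (a ⁻¹) (φ a) (φ c) ⟩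
          c ⁻¹ * (a ⁻¹ * φ a) * φ c    ≡⟨ cong (_* φ c) (K-commutative (proj₁ (unit-⁻¹ uc))
                                            (*∈ (proj₁ (unit-⁻¹ unit-a)) (y^-normalizes n (proj₁ unit-a)))) ⟩
          a ⁻¹ * φ a * c ⁻¹ * φ c      ≡⟨ *-assoc _ _ _ ⟩
          a ⁻¹ * φ a * (c ⁻¹ * φ c)    ∎
        -- A trivial value at `a` would mean that y^n commutes with `a` and so lies in `K`, against
        -- the minimality of `t`.
        moves : a ⁻¹ * φ a ≢ 1#
        moves eq = y^∉K (toℕ i) (Fin.toℕ<n i) (P.^∈ n y∈P , (begin
          y ^ n * a     ≡⟨ conj-swap (^-nonzero y≢0 n) a ⟩
          φ a * y ^ n   ≡⟨ cong (_* y ^ n) (*-cancelˡ (a ⁻¹) (⁻¹-nonzero a≢0) (trans eq (sym (inverseˡ a≢0)))) ⟩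
          a * y ^ n     ∎))

      -- An analogue of Dedekind's independence of characters: multiplication by c⁻¹ turns the i-th
      -- term into χ_i(c) y^i v_i, and summing over c leaves -v₀.
      y^-independent : ∀ (v : Fin t → Fin m) →
        (∀ c → Unit c → sum (λ i → y ^ toℕ i * c * v i) ≡ 0#) → v Fin.zero ≡ 0#
      y^-independent v vanishes = begin
        v Fin.zero                                                    ≡⟨ *-identityˡ _ ⟨
        1# * v Fin.zero                                               ≡⟨ -‿involutive _ ⟨
        - - (1# * v Fin.zero)                                         ≡⟨ cong -_ (orthogonality χ w χ₀ χ-nontrivial) ⟨
        - ∑* (λ c → sum (λ i → χ i c * w i))                          ≡⟨ cong -_ (∑*-zero λ c uc → trans (sum-cong-≗ {t} (factor c uc))
                                                                          (trans (sym (*-distribˡ-sum {t} (c ⁻¹) (λ i → y ^ toℕ i * c * v i)))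
                                                                          (trans (cong (c ⁻¹ *_) (vanishes c uc)) (zeroʳ _)))) ⟩
        - 0#                                                          ≡⟨ -0#≈0# ⟩
        0#                                                            ∎
        where
        w : Fin t → Fin m
        w i = y ^ toℕ i * v i
        χ₀ : ∀ c → Unit c → c ⁻¹ * conj 1# c ≡ 1#
        χ₀ c uc = trans (cong (c ⁻¹ *_) (conj-1 c)) (inverseˡ (proj₂ uc))
        factor : ∀ c → Unit c → ∀ i → χ i c * w i ≡ c ⁻¹ * (y ^ toℕ i * c * v i)
        factor c uc i = trans (*-assoc _ _ _) (cong (c ⁻¹ *_)
          (cancel-innerˡ (^-nonzero y≢0 (toℕ i)) (y ^ toℕ i * c) (v i)))

      -- Hilbert 90 in the guise of conjugacy: the intertwiner is a sum Σ y^i c y′^{-i}.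
      intertwiner : ∀ {y′} → y′ ≢ 0# → y′ ^ t ≡ ν k → ∃ λ c → Unit c ×
        let S = sum {t} (λ i → y ^ toℕ i * c * (y′ ⁻¹) ^ toℕ i) in S ≢ 0# × y * S ≡ S * y′
      intertwiner {y′} y′≢0 same =
        -- If every S c were 0, `y^-independent` with v_i = y′^(-i) would give v₀ = 1 = 0.
        let c , uc , S≢0 = decidable-stable (Fin.any? (λ c → unit? c ×-dec ¬? (S c Fin.≟ 0#)))
              (λ none → 1≢0 (y^-independent (λ i → (y′ ⁻¹) ^ toℕ i)
                (λ c uc → decidable-stable (S c Fin.≟ 0#) (λ S≢0 → none (c , uc , S≢0)))))
        in c , uc , S≢0 , (begin
          y * S c              ≡⟨ cancel-lastʳ y′≢0 _ ⟨
          y * S c * y′ ⁻¹ * y′ ≡⟨ cong (_* y′) (twisted-sum-fixed t y (y′ ⁻¹) c (wrap (proj₁ (proj₁ uc)))) ⟩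
          S c * y′             ∎)
        where
        S : Fin m → Fin m
        S c = sum {t} (λ i → y ^ toℕ i * c * (y′ ⁻¹) ^ toℕ i)
        -- y^t and y′^t agree and are central in `P`, so the twisted orbit of c closes after t
        -- steps.
        wrap : ∀ {c} → P.Mem c → y ^ t * c * (y′ ⁻¹) ^ t ≡ c
        wrap {c} c∈ = begin
          y ^ t * c * (y′ ⁻¹) ^ t ≡⟨ cong (y ^ t * c *_) (⁻¹-^ y′≢0 t) ⟩
          y ^ t * c * (y′ ^ t) ⁻¹ ≡⟨ cong (λ w → y ^ t * c * w ⁻¹) same ⟩
          conj (ν k) c            ≡⟨ conj-fixed (proj₂ ν-unit) (ν-central c∈) ⟩
          c                       ∎

      -- With y′ = 1 the intertwiner gives y S = S, so y = 1, although `y` does not commute with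
      -- `a`.
      ν≢1 : ν k ≢ 1#
      ν≢1 νk≡1 =
        let c , uc , S≢0 , yS≡S = intertwiner 1≢0 (trans (1^n≡1 t) (sym νk≡1))
            y≡1 = *-cancelʳ _ S≢0 (trans yS≡S (trans (*-identityʳ _) (sym (*-identityˡ _))))
        in y≁a (subst (λ w → Commute w a) (sym y≡1) (trans (*-identityˡ a) (sym (*-identityʳ a))))

      -- The intertwiner u of k x and k′ x lies in `K`, because in each of its terms the powers of x
      -- form a conjugation. Thus k x u = u k′ x reads k τ(u) = u k′.
      hilbert-90 : ∀ {k′} → Unit k′ → ν k ≡ ν k′ → ∃ λ u → Unit u × u ≡ k * k′ ⁻¹ * τ u
      hilbert-90 {k′} uk′ same =
        let c , uc , S≢0 , yS≡Sy′ = intertwiner (*-nonzero (proj₂ uk′) x≢0) (sym same)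
            u = sum {t} (λ i → (k * x) ^ toℕ i * c * ((k′ * x) ⁻¹) ^ toℕ i)
            u∈ : Mem u
            u∈ = sum∈ {t} _ (λ i → term∈ c (proj₁ uc) (toℕ i))
            kτu≡uk′ : k * τ u ≡ u * k′
            kτu≡uk′ = *-cancelʳ x x≢0 (begin
              k * τ u * x   ≡⟨ *-assoc _ _ _ ⟩
              k * (τ u * x) ≡⟨ cong (k *_) (conj-swap x≢0 u) ⟨
              k * (x * u)   ≡⟨ *-assoc _ _ _ ⟨
              k * x * u     ≡⟨ yS≡Sy′ ⟩
              u * (k′ * x)  ≡⟨ *-assoc _ _ _ ⟨
              u * k′ * x    ∎)
        in u , (u∈ , S≢0) , *-cancelʳ k′ (proj₂ uk′) (begin
          u * k′                  ≡⟨ kτu≡uk′ ⟨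
          k * τ u                 ≡⟨ cancel-innerˡ (proj₂ uk′) k (τ u) ⟨
          k * k′ ⁻¹ * (k′ * τ u)  ≡⟨ cong (k * k′ ⁻¹ *_) (K-commutative (proj₁ uk′) (τ∈ u∈)) ⟩
          k * k′ ⁻¹ * (τ u * k′)  ≡⟨ *-assoc _ _ _ ⟨
          k * k′ ⁻¹ * τ u * k′    ∎)
        where
        term∈ : ∀ c → Mem c → ∀ i → Mem ((k * x) ^ i * c * ((k′ * x) ⁻¹) ^ i)
        term∈ c c∈ i =
          let e , ue , eq = power-form uk i
              e′ , ue′ , eq′ = power-form uk′ i
              X = x ^ i
              X≢0 = ^-nonzero x≢0 i
          in subst Mem (begin
            e * conj X c * e′ ⁻¹                           ≡⟨ rearrange e X c (X ⁻¹) (e′ ⁻¹) ⟩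
            e * X * c * (X ⁻¹ * e′ ⁻¹)                     ≡⟨ cong (e * X * c *_) (⁻¹-* (proj₂ ue′) X≢0) ⟨
            e * X * c * (e′ * X) ⁻¹                        ≡⟨ cong₂ (λ p q → p * c * q ⁻¹) eq eq′ ⟨
            (k * x) ^ i * c * ((k′ * x) ^ i) ⁻¹            ≡⟨ cong ((k * x) ^ i * c *_) (⁻¹-^ (*-nonzero (proj₂ uk′) x≢0) i) ⟨
            (k * x) ^ i * c * ((k′ * x) ⁻¹) ^ i            ∎)
            (*∈ (*∈ (proj₁ ue) (x^-normalizes i c∈)) (proj₁ (unit-⁻¹ ue′)))
          where
          rearrange : ∀ p q r s t → p * (q * r * s) * t ≡ p * q * r * (s * t)
          rearrange p q r s t = solve *-monoid

    R : Fin m → Fin m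
    R v = section (λ k → unit? k ×-dec ν k Fin.≟ v)

    R-correct : ∀ {k} → Unit k → Unit (R (ν k)) × ν (R (ν k)) ≡ ν k
    R-correct {k} uk = section-correct (λ k′ → unit? k′ ×-dec ν k′ Fin.≟ ν k) {k} (uk , refl)

    L : Fin m → Fin m
    L β = section (λ u → unit? u ×-dec u Fin.≟ β * τ u)

    L-correct : ∀ {β u} → Unit u → u ≡ β * τ u → Unit (L β) × L β ≡ β * τ (L β)
    L-correct {β} {u} uu eq = section-correct (λ u → unit? u ×-dec u Fin.≟ β * τ u) {u} (uu , eq)

    -- A quotient of two elements with the same norm, so by Hilbert 90 the equation u = β τ(u) has a
    -- solution among the units.
    β : Fin m → Fin m
    β k = k * R (ν k) ⁻¹

    -- The pair (β k , ν k) determines k, and f k determines the pair.  So f is injective on the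
    -- finite set of units of K, hence onto; this is |im ν| = |K*| / |ker| = |Z*|.
    f : Fin m → Fin m
    f k = choose (unit? k) (L (β k) * ν k) k

    f-unit : ∀ {k} → Unit k → f k ≡ L (β k) * ν k
    f-unit {k} uk = choose-yes (unit? k) uk

    f-nonunit : ∀ {k} → ¬ Unit k → f k ≡ k
    f-nonunit {k} ¬uk = choose-no (unit? k) ¬uk

    Lβ : ∀ {k} → Unit k → Unit (L (β k)) × L (β k) ≡ β k * τ (L (β k))
    Lβ uk = let uR , eq = R-correct uk
                u , uu , eq′ = hilbert-90 uk uR (sym eq)
            in L-correct uu eq′

    unit-f : ∀ {k} → Unit k → Unit (f k)
    unit-f uk = subst Unit (sym (f-unit uk)) (unit-* (proj₁ (Lβ uk)) (ν-unit uk))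

    -- ν k is central, hence fixed by τ, so multiplying the solution `L (β k)` by it gives another
    -- solution of the same equation. In this way f k retains β k.
    f-twist : ∀ {k} → Unit k → f k ≡ β k * τ (f k)
    f-twist {k} uk = begin
      f k                            ≡⟨ f-unit uk ⟩
      L (β k) * ν k                  ≡⟨ cong (_* ν k) (proj₂ (Lβ uk)) ⟩
      β k * τ (L (β k)) * ν k        ≡⟨ *-assoc _ _ _ ⟩
      β k * (τ (L (β k)) * ν k)      ≡⟨ cong (λ w → β k * (τ (L (β k)) * w)) (conj-fixed x≢0 (sym (ν-central uk x∈P))) ⟨
      β k * (τ (L (β k)) * τ (ν k))  ≡⟨ cong (β k *_) (conj-* x≢0 (L (β k)) (ν k)) ⟨
      β k * τ (L (β k) * ν k)        ≡⟨ cong (λ w → β k * τ w) (f-unit uk) ⟨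
      β k * τ (f k)                  ∎

    f-determines-β : ∀ {k γ} → Unit k → f k ≡ γ * τ (f k) → β k ≡ γ
    f-determines-β {k} uk eq = *-cancelʳ (τ (f k)) (proj₂ (τ-unit (unit-f uk))) (trans (sym (f-twist uk)) eq)

    f-injective-on-units : ∀ {k k′} → Unit k → Unit k′ → f k ≡ f k′ → k ≡ k′
    f-injective-on-units {k} {k′} uk uk′ eq = begin
      k                             ≡⟨ cancel-lastʳ (proj₂ (proj₁ (R-correct uk))) k ⟨
      β k * R (ν k)                 ≡⟨ cong₂ _*_ β≡ (cong R ν≡) ⟩
      β k′ * R (ν k′)               ≡⟨ cancel-lastʳ (proj₂ (proj₁ (R-correct uk′))) k′ ⟩
      k′                            ∎
      where
      β≡ : β k ≡ β k′
      β≡ = f-determines-β uk (subst (λ w → w ≡ β k′ * τ w) (sym eq) (f-twist uk′))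
      ν≡ : ν k ≡ ν k′
      ν≡ = *-cancelˡ (L (β k)) (proj₂ (proj₁ (Lβ uk))) (begin
        L (β k) * ν k   ≡⟨ f-unit uk ⟨
        f k             ≡⟨ eq ⟩
        f k′            ≡⟨ f-unit uk′ ⟩
        L (β k′) * ν k′ ≡⟨ cong (λ w → L w * ν k′) β≡ ⟨
        L (β k) * ν k′  ∎)

    f-injective : Injective _≡_ _≡_ f
    f-injective {k} {k′} eq = helper (unit? k) (unit? k′)
      where
      helper : Dec (Unit k) → Dec (Unit k′) → k ≡ k′
      helper (yes uk) (yes uk′) = f-injective-on-units uk uk′ eq
      helper (yes uk) (no ¬uk′) = contradiction (subst Unit (trans eq (f-nonunit ¬uk′)) (unit-f uk)) ¬uk′
      helper (no ¬uk) (yes uk′) = contradiction (subst Unit (trans (sym eq) (f-nonunit ¬uk)) (unit-f uk′)) ¬uk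
      helper (no ¬uk) (no ¬uk′) = trans (sym (f-nonunit ¬uk)) (trans eq (f-nonunit ¬uk′))

    -- v = L 1 is fixed by τ, so a preimage k would have β k = 1. Then v ν k = f k = v, and ν k = 1.
    no-fixed-preimage : ∀ {k v} → Unit v → v ≡ 1# * τ v → L 1# ≡ v → f k ≢ v
    no-fixed-preimage {k} {v} uv v-twist L1≡v fk≡v = ν≢1 uk (*-cancelˡ v (proj₂ uv) (begin
      v * ν k         ≡⟨ cong (_* ν k) L1≡v ⟨
      L 1# * ν k      ≡⟨ cong (λ w → L w * ν k) (f-determines-β uk (subst (λ w → w ≡ 1# * τ w) (sym fk≡v) v-twist)) ⟨
      L (β k) * ν k   ≡⟨ f-unit uk ⟨
      f k             ≡⟨ fk≡v ⟩
      v               ≡⟨ *-identityʳ v ⟨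
      v * 1#          ∎))
      where
      uk : Unit k
      uk = decidable-stable (unit? k) (λ ¬uk → ¬uk (subst Unit (trans (sym fk≡v) (f-nonunit ¬uk)) uv))

    impossible : ⊥
    impossible =
      let uv , v-twist = L-correct {1#} {1#} (1∈ , 1≢0)
            (sym (trans (*-identityˡ _) (conj-fixed x≢0 (trans (*-identityʳ x) (sym (*-identityˡ x))))))
          k , fk≡v = injective⇒surjective f f-injective (L 1#)
      in no-fixed-preimage uv v-twist refl fk≡v

module _ {m : ℕ} (D : FiniteDivisionRing m) where
  open DivisionRingProperties D
  open DivisionSubring

  -- Induction on the number of elements: `d` lies in `P` but not in the centralizer of `c`, which
  -- is therefore smaller.
  subring-commutative : ∀ P → Acc ℕ._<_ (count (mem? P)) → ∀ {a b} → Mem P a → Mem P b → Commute a b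
  subring-commutative P (acc rec) {a} {b} a∈ b∈ = decidable-stable (commute? a b)
    (MinimalNoncommutative.Contradiction.impossible D P smaller a∈ b∈)
    where
    smaller : ∀ {c d x y} → Mem P c → Mem P d → Mem P x → Mem P y →
              ¬ Commute c d → Commute x c → Commute y c → Commute x y
    smaller {c} {d} c∈ d∈ x∈ y∈ c≁d xc yc = subring-commutative (centralizer P c)
      (rec (count-mono-< (mem? (centralizer P c)) (mem? P) (λ _ → proj₁) d d∈ (λ (_ , dc) → c≁d (sym dc))))
      (x∈ , xc) (y∈ , yc)

  wedderburn : ∀ a b → Commute a b
  wedderburn a b = subring-commutative whole (ℕ.<-wellFounded _) tt tt

-- Vectors over a finite field

funToFin-cong : ∀ {m n} {f g : Fin m → Fin n} → (∀ i → f i ≡ g i) → funToFin f ≡ funToFin g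
funToFin-cong {zero} eq = refl
funToFin-cong {suc m} eq = cong₂ combine (eq Fin.zero) (funToFin-cong (eq ∘ Fin.suc))

module LinearAlgebra (F : Field) {q : ℕ} (order : HasOrder F q) where
  open Field F using (isCommutativeRing)
  open VectorSpace F

  commutativeRing : CommutativeRing 0ℓ 0ℓ
  commutativeRing = record { isCommutativeRing = isCommutativeRing }

  open CommutativeRing commutativeRing hiding (refl; sym; trans; reflexive; isEquivalence; isCommutativeRing; _≈_)
  open import Algebra.Properties.Ring ring
  open import Algebra.Properties.Semiring.Sum semiring
  open ≡-Reasoning
  open Inverse order using (to; from; inverseˡ; inverseʳ)

  _≟_ : (x y : Carrier) → Dec (x ≡ y)
  x ≟ y = map′ (λ eq → trans (sym (inverseˡ refl)) (trans (cong to eq) (inverseˡ refl))) (cong from) (from x Fin.≟ from y)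

  ≈-sym : ∀ {N} {u v : Vect N} → u ≈ v → v ≈ u
  ≈-sym eq i = sym (eq i)

  ≈-trans : ∀ {N} {u v w : Vect N} → u ≈ v → v ≈ w → u ≈ w
  ≈-trans eq eq′ i = trans (eq i) (eq′ i)

  nonzero? : ∀ {N} (v : Vect N) → Dec (NonZero v)
  nonzero? v = Fin.any? (λ i → ¬? (v i ≟ 0#))

  ¬nonzero⇒≈0 : ∀ {N} {v : Vect N} → ¬ NonZero v → v ≈ 0v
  ¬nonzero⇒≈0 {v = v} ¬nz i = decidable-stable (v i ≟ 0#) (λ vi≢0 → ¬nz (i , vi≢0))

  sum-single : ∀ {n} (i : Fin n) (f : Fin n → Carrier) → (∀ j → j ≢ i → f j ≡ 0#) → sum f ≡ f i
  sum-single {suc n} i f rest = begin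
    sum f                                 ≡⟨ sum-remove {n} {i} f ⟩
    f i + sum (λ j → f (punchIn i j))     ≡⟨ cong (f i +_) (trans (sum-cong-≗ (λ j → rest _ (Fin.punchInᵢ≢i i j))) (sum-replicate-zero n)) ⟩
    f i + 0#                              ≡⟨ +-identityʳ _ ⟩
    f i                                   ∎

  lincomb-sum : ∀ {N} m (c : Fin m → Carrier) (b : Fin m → Vect N) i → lincomb m c b i ≡ sum (λ k → c k * b k i)
  lincomb-sum zero c b i = refl
  lincomb-sum (suc m) c b i = cong (c Fin.zero * b Fin.zero i +_) (lincomb-sum m (c ∘ Fin.suc) (b ∘ Fin.suc) i)

  lincomb-cong : ∀ {N} m {c d : Fin m → Carrier} (b : Fin m → Vect N) → (∀ k → c k ≡ d k) → lincomb m c b ≈ lincomb m d b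
  lincomb-cong m {c} {d} b c≡d i = begin
    lincomb m c b i            ≡⟨ lincomb-sum m c b i ⟩
    sum (λ k → c k * b k i)    ≡⟨ sum-cong-≗ (λ k → cong (_* b k i) (c≡d k)) ⟩
    sum (λ k → d k * b k i)    ≡⟨ lincomb-sum m d b i ⟨
    lincomb m d b i            ∎

  lincomb-+ : ∀ {N} m (c d : Fin m → Carrier) (b : Fin m → Vect N) →
              lincomb m (c +v d) b ≈ (lincomb m c b +v lincomb m d b)
  lincomb-+ m c d b i = begin
    lincomb m (c +v d) b i                            ≡⟨ lincomb-sum m (c +v d) b i ⟩
    sum (λ k → (c k + d k) * b k i)                   ≡⟨ sum-cong-≗ (λ k → distribʳ (b k i) (c k) (d k)) ⟩
    sum (λ k → c k * b k i + d k * b k i)             ≡⟨ ∑-distrib-+ (λ k → c k * b k i) (λ k → d k * b k i) ⟩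
    sum (λ k → c k * b k i) + sum (λ k → d k * b k i) ≡⟨ cong₂ _+_ (lincomb-sum m c b i) (lincomb-sum m d b i) ⟨
    lincomb m c b i + lincomb m d b i                 ∎

  lincomb-· : ∀ {N} m s (c : Fin m → Carrier) (b : Fin m → Vect N) →
              lincomb m (s · c) b ≈ (s · lincomb m c b)
  lincomb-· m s c b i = begin
    lincomb m (s · c) b i           ≡⟨ lincomb-sum m (s · c) b i ⟩
    sum (λ k → s * c k * b k i)     ≡⟨ sum-cong-≗ (λ k → *-assoc s (c k) (b k i)) ⟩
    sum (λ k → s * (c k * b k i))   ≡⟨ *-distribˡ-sum s (λ k → c k * b k i) ⟨
    s * sum (λ k → c k * b k i)     ≡⟨ cong (s *_) (lincomb-sum m c b i) ⟨
    s * lincomb m c b i             ∎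

  lincomb-0 : ∀ {N} m {c : Fin m → Carrier} (b : Fin m → Vect N) → (∀ k → c k ≡ 0#) → lincomb m c b ≈ 0v
  lincomb-0 m {c} b c≡0 i = trans (lincomb-sum m c b i)
    (trans (sum-cong-≗ (λ k → trans (cong (_* b k i) (c≡0 k)) (zeroˡ _))) (sum-replicate-zero m))

  δ : ∀ {m} → Fin m → Fin m → Carrier
  δ k l with k Fin.≟ l
  ... | yes _ = 1#
  ... | no _ = 0#

  δ-diag : ∀ {m} (k : Fin m) → δ k k ≡ 1#
  δ-diag k with k Fin.≟ k
  ... | yes _ = refl
  ... | no k≢k = contradiction refl k≢k

  δ-off : ∀ {m} {k l : Fin m} → k ≢ l → δ k l ≡ 0#
  δ-off {k = k} {l} k≢l with k Fin.≟ l
  ... | yes k≡l = contradiction k≡l k≢l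
  ... | no _ = refl

  lincomb-δ : ∀ {N} m (k : Fin m) (b : Fin m → Vect N) → lincomb m (δ k) b ≈ b k
  lincomb-δ m k b i = begin
    lincomb m (δ k) b i       ≡⟨ lincomb-sum m (δ k) b i ⟩
    sum (λ l → δ k l * b l i) ≡⟨ sum-single k (λ l → δ k l * b l i) (λ l l≢k → trans (cong (_* b l i) (δ-off (l≢k ∘ sym))) (zeroˡ _)) ⟩
    δ k k * b k i             ≡⟨ cong (_* b k i) (δ-diag k) ⟩
    1# * b k i                ≡⟨ *-identityˡ _ ⟩
    b k i                     ∎

  lincomb∈ : ∀ {N} m (c : Fin m → Carrier) (b : Fin m → Vect N) {A : Set} {g : A → Vect N} →
             (∀ k → InSpan g (b k)) → InSpan g (lincomb m c b)
  lincomb∈ zero c b b∈ = span-0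
  lincomb∈ (suc m) c b b∈ = span-+ (span-· _ (b∈ Fin.zero)) (lincomb∈ m _ _ (b∈ ∘ Fin.suc))

  span⇒lincomb : ∀ {N m} {b : Fin m → Vect N} {v} → InSpan b v → ∃ λ c → v ≈ lincomb m c b
  span⇒lincomb {m = m} {b} span-0 = (λ _ → 0#) , ≈-sym (lincomb-0 m b (λ _ → refl))
  span⇒lincomb {m = m} {b} (span-gen k) = δ k , ≈-sym (lincomb-δ m k b)
  span⇒lincomb {m = m} {b} (span-+ u∈ v∈) =
    let c , u≈ = span⇒lincomb u∈ ; d , v≈ = span⇒lincomb v∈ in
    c +v d , λ i → trans (cong₂ _+_ (u≈ i) (v≈ i)) (sym (lincomb-+ m c d b i))
  span⇒lincomb {m = m} {b} (span-· s v∈) =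
    let c , v≈ = span⇒lincomb v∈ in
    s · c , λ i → trans (cong (s *_) (v≈ i)) (sym (lincomb-· m s c b i))
  span⇒lincomb (span-resp u≈v u∈) = let c , u≈ = span⇒lincomb u∈ in c , ≈-trans (≈-sym u≈v) u≈

  span-join : ∀ {N} {A B : Set} {g : A → Vect N} {h : B → Vect N} {v} → InSpan [ g , h ] v →
              ∃₂ λ u w → InSpan g u × InSpan h w × v ≈ (u +v w)
  span-join span-0 = 0v , 0v , span-0 , span-0 , λ _ → sym (+-identityˡ _)
  span-join (span-gen (inj₁ a)) = _ , 0v , span-gen a , span-0 , λ _ → sym (+-identityʳ _)
  span-join (span-gen (inj₂ b)) = 0v , _ , span-0 , span-gen b , λ _ → sym (+-identityˡ _)
  span-join (span-+ v∈ v′∈) =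
    let u , w , u∈ , w∈ , eq = span-join v∈
        u′ , w′ , u′∈ , w′∈ , eq′ = span-join v′∈
    in u +v u′ , w +v w′ , span-+ u∈ u′∈ , span-+ w∈ w′∈ ,
       λ i → trans (cong₂ _+_ (eq i) (eq′ i)) (interchange (u i) (w i) (u′ i) (w′ i))
    where
    open import Algebra.Properties.CommutativeSemigroup +-commutativeSemigroup using (interchange)
  span-join (span-· c v∈) =
    let u , w , u∈ , w∈ , eq = span-join v∈ in
    c · u , c · w , span-· c u∈ , span-· c w∈ , λ i → trans (cong (c *_) (eq i)) (distribˡ c (u i) (w i))
  span-join (span-resp v≈ v∈) =
    let u , w , u∈ , w∈ , eq = span-join v∈ in u , w , u∈ , w∈ , ≈-trans (≈-sym v≈) eq

  span-mono : ∀ {N} {A B : Set} {g : A → Vect N} {h : B → Vect N} {v} →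
              (∀ a → InSpan h (g a)) → InSpan g v → InSpan h v
  span-mono g⊆h span-0 = span-0
  span-mono g⊆h (span-gen a) = g⊆h a
  span-mono g⊆h (span-+ u∈ v∈) = span-+ (span-mono g⊆h u∈) (span-mono g⊆h v∈)
  span-mono g⊆h (span-· c v∈) = span-· c (span-mono g⊆h v∈)
  span-mono g⊆h (span-resp eq v∈) = span-resp eq (span-mono g⊆h v∈)

  -- Vectors are functions and compared pointwise; codes turn this into propositional equality on a
  -- finite set, as the carrier of a `Field` demands.
  encode : ∀ {n} → Vect n → Fin (q ℕ.^ n)
  encode v = funToFin (from ∘ v)

  decode : ∀ {n} → Fin (q ℕ.^ n) → Vect n
  decode w = to ∘ finToFun w

  encode-cong : ∀ {n} {u v : Vect n} → u ≈ v → encode u ≡ encode v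
  encode-cong u≈v = funToFin-cong (cong from ∘ u≈v)

  decode-encode : ∀ {n} (v : Vect n) → decode (encode v) ≈ v
  decode-encode v i = trans (cong to (Fin.finToFun-funToFin (from ∘ v) i)) (inverseˡ refl)

  encode-decode : ∀ {n} (w : Fin (q ℕ.^ n)) → encode {n} (decode w) ≡ w
  encode-decode {n} w = trans (funToFin-cong {n} {g = finToFun w} (λ i → inverseʳ refl)) (Fin.funToFin-finToFin {n} {q} w)

  decode-injective : ∀ {n} {w w′ : Fin (q ℕ.^ n)} → decode {n} w ≈ decode w′ → w ≡ w′
  decode-injective {n} eq = trans (sym (encode-decode {n} _)) (trans (encode-cong eq) (encode-decode {n} _))

  module Codes (n : ℕ) where
    W : Set
    W = Fin (q ℕ.^ n)

    infixl 6 _⊕_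
    infixl 7 _⊙_

    _⊕_ : W → W → W
    w ⊕ w′ = encode {n} (decode w +v decode w′)

    _⊙_ : Carrier → W → W
    c ⊙ w = encode {n} (c · decode w)

    ⊖_ : W → W
    ⊖ w = encode {n} (λ i → - decode w i)

    𝟘 : W
    𝟘 = encode {n} 0v

    ⊕-isAbelianGroup : IsAbelianGroup _≡_ _⊕_ 𝟘 ⊖_
    ⊕-isAbelianGroup = record
      { isGroup = record
        { isMonoid = record
          { isSemigroup = record
            { isMagma = record { isEquivalence = isEquivalence ; ∙-cong = cong₂ _⊕_ }
            ; assoc = λ x y z → encode-cong {n} (λ i → trans (cong (_+ _) (decode-encode _ i))
                (trans (+-assoc _ _ _) (cong (_ +_) (sym (decode-encode _ i)))))
            }
          ; identity = (λ x → trans (encode-cong {n} (λ i → trans (cong (_+ _) (decode-encode {n} 0v i)) (+-identityˡ _))) (encode-decode {n} x))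
                     , (λ x → trans (encode-cong {n} (λ i → trans (cong (_ +_) (decode-encode {n} 0v i)) (+-identityʳ _))) (encode-decode {n} x))
          }
        ; inverse = (λ x → encode-cong {n} (λ i → trans (cong (_+ _) (decode-encode {n} _ i)) (-‿inverseˡ _)))
                  , (λ x → encode-cong {n} (λ i → trans (cong (_ +_) (decode-encode {n} _ i)) (-‿inverseʳ _)))
        ; ⁻¹-cong = cong ⊖_
        }
      ; comm = λ x y → encode-cong {n} (λ i → +-comm _ _)
      }

    ⊙-distribʳ : ∀ c d x → (c + d) ⊙ x ≡ c ⊙ x ⊕ d ⊙ x
    ⊙-distribʳ c d x = encode-cong {n} (λ i → trans (distribʳ _ c d)
      (sym (cong₂ _+_ (decode-encode {n} _ i) (decode-encode {n} _ i))))

    ⊙-assoc : ∀ c d x → (c * d) ⊙ x ≡ c ⊙ (d ⊙ x)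
    ⊙-assoc c d x = encode-cong {n} (λ i → trans (*-assoc c d _) (cong (c *_) (sym (decode-encode {n} _ i))))

    ⊙-identityˡ : ∀ x → 1# ⊙ x ≡ x
    ⊙-identityˡ x = trans (encode-cong {n} (λ i → *-identityˡ _)) (encode-decode {n} x)

    ⊙-zeroˡ : ∀ x → 0# ⊙ x ≡ 𝟘
    ⊙-zeroˡ x = encode-cong {n} (λ i → zeroˡ _)

    ⊙-neg : ∀ x → - 1# ⊙ x ≡ ⊖ x
    ⊙-neg x = encode-cong {n} (λ i → -1*x≈-x _)

-- Coordinates adapted to spanning elements

module _ (F : Field) {q : ℕ} (order : HasOrder F q) where
  open VectorSpace F
  open LinearAlgebra F order

  -- There are two models: expansion in the bases of the spanning elements, and its `rescaled`
  -- version. What is proved from the interface serves both.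
  record Coordinates {N n r} (S : Spread F N n) (e : Fin r → Spread.Index S) : Set where
    open Spread S
    open Codes n
    field
      π      : Fin r → Vect N → W
      π-cong : ∀ a {u v} → u ≈ v → π a u ≡ π a v
      π-+    : ∀ a u v → π a (u +v v) ≡ π a u ⊕ π a v
      π-·    : ∀ a c v → π a (c · v) ≡ c ⊙ π a v
      π-ext  : ∀ {u v} → (∀ a → π a u ≡ π a v) → u ≈ v
      vec    : (Fin r → W) → Vect N
      π-vec  : ∀ a x → π a (vec x) ≡ x a
      axis⇒  : ∀ {a v} → InSpan (basis (e a)) v → ∀ b → b ≢ a → π b v ≡ 𝟘
      axis⇐  : ∀ {a v} → (∀ b → b ≢ a → π b v ≡ 𝟘) → InSpan (basis (e a)) v

  module SpanningElements {n r} (S : Spread F (r ℕ.* n) n) (e : Fin r → Spread.Index S)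
    (spanning : ∀ v → InSpan (λ (p : Σ (Fin r) λ _ → Fin n) → Spread.basis S (e (proj₁ p)) (proj₂ p)) v) where
    open CommutativeRing commutativeRing hiding (refl; sym; trans; reflexive; isEquivalence; isCommutativeRing; _≈_)
    open import Algebra.Properties.Semiring.Sum semiring
    open ≡-Reasoning
    open Spread S
    open Codes n

    N : ℕ
    N = r ℕ.* n

    component : (Fin r → Vect n) → Fin r → Vect N
    component C a = lincomb n (C a) (basis (e a))

    Φ : (Fin r → Vect n) → Vect N
    Φ C i = sum (λ a → component C a i)

    Φ-cong : ∀ {C C′} → (∀ a → C a ≈ C′ a) → Φ C ≈ Φ C′
    Φ-cong eq i = sum-cong-≗ (λ a → lincomb-cong n (basis (e a)) (eq a) i)

    Φ-+ : ∀ C C′ → Φ (λ a → C a +v C′ a) ≈ (Φ C +v Φ C′)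
    Φ-+ C C′ i = trans (sum-cong-≗ (λ a → lincomb-+ n (C a) (C′ a) (basis (e a)) i))
      (∑-distrib-+ (λ a → component C a i) (λ a → component C′ a i))

    Φ-· : ∀ c C → Φ (λ a → c · C a) ≈ (c · Φ C)
    Φ-· c C i = trans (sum-cong-≗ (λ a → lincomb-· n c (C a) (basis (e a)) i))
      (sym (*-distribˡ-sum c (λ a → component C a i)))

    Φ-single : ∀ C a → (∀ b → b ≢ a → C b ≈ 0v) → Φ C ≈ component C a
    Φ-single C a rest i = sum-single a (λ b → component C b i) (λ b b≢a → lincomb-0 n (basis (e b)) (rest b b≢a) i)

    Φ-0 : ∀ {C} → (∀ a → C a ≈ 0v) → Φ C ≈ 0v
    Φ-0 C≈0 i = trans (sum-cong-≗ (λ a → lincomb-0 n (basis (e a)) (C≈0 a) i)) (sum-replicate-zero r)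

    coefficients : ∀ {v} → InSpan (λ (p : Σ (Fin r) λ _ → Fin n) → basis (e (proj₁ p)) (proj₂ p)) v →
                   ∃ λ C → v ≈ Φ C
    coefficients span-0 = (λ _ → 0v) , ≈-sym (Φ-0 (λ _ _ → refl))
    coefficients (span-gen (a , k)) = C , ≈-sym (≈-trans
        (Φ-single C a (λ b b≢a l → trans (cong (_* δ k l) (δ-off (b≢a ∘ sym))) (zeroˡ _)))
        (≈-trans (lincomb-cong n (basis (e a)) (λ l → trans (cong (_* δ k l) (δ-diag a)) (*-identityˡ _)))
          (lincomb-δ n k (basis (e a)))))
      where
      C : Fin r → Vect n
      C b l = δ a b * δ k l
    coefficients (span-+ u∈ v∈) =
      let C , u≈ = coefficients u∈ ; C′ , v≈ = coefficients v∈ in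
      (λ a → C a +v C′ a) , λ i → trans (cong₂ _+_ (u≈ i) (v≈ i)) (sym (Φ-+ C C′ i))
    coefficients (span-· c v∈) =
      let C , v≈ = coefficients v∈ in (λ a → c · C a) , λ i → trans (cong (c *_) (v≈ i)) (sym (Φ-· c C i))
    coefficients (span-resp u≈v u∈) = let C , u≈ = coefficients u∈ in C , ≈-trans (≈-sym u≈v) u≈

    -- Coefficients in the spanning family, not yet known to be unique. Taking the code of a vector
    -- as input makes them respect `≈`.
    code : Fin (q ℕ.^ N) → Fin ((q ℕ.^ n) ℕ.^ r)
    code c = funToFin (λ a → encode (proj₁ (coefficients (spanning (decode c))) a))

    π : Fin r → Vect N → W
    π a v = finToFun (code (encode v)) a

    vec : (Fin r → W) → Vect N
    vec x = Φ (λ a → decode (x a))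

    Φ-π : ∀ v → vec (λ a → π a v) ≈ v
    Φ-π v = ≈-trans (Φ-cong (λ a → ≈-trans (λ i → cong (λ w → decode w i) (Fin.finToFun-funToFin _ a)) (decode-encode _)))
      (≈-trans (≈-sym (proj₂ (coefficients (spanning (decode (encode v)))))) (decode-encode v))

    π-cong : ∀ a {u v} → u ≈ v → π a u ≡ π a v
    π-cong a u≈v = cong (λ c → finToFun (code c) a) (encode-cong u≈v)

    π-ext : ∀ {u v} → (∀ a → π a u ≡ π a v) → u ≈ v
    π-ext {u} {v} eq = ≈-trans (≈-sym (Φ-π u)) (≈-trans (Φ-cong (λ a i → cong (λ w → decode w i) (eq a))) (Φ-π v))

    sizes : q ℕ.^ N ≡ (q ℕ.^ n) ℕ.^ r
    sizes = trans (cong (q ℕ.^_) (ℕ.*-comm r n)) (sym (ℕ.^-*-assoc q n r))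

    code-injective : Injective _≡_ _≡_ code
    code-injective {c} {d} eq = begin
      c                            ≡⟨ encode-decode {N} c ⟨
      encode {N} (decode c)        ≡⟨ encode-cong (π-ext (λ a → cong (λ w → finToFun w a) (begin
          code (encode {N} (decode c)) ≡⟨ cong code (encode-decode {N} c) ⟩
          code c                       ≡⟨ eq ⟩
          code d                       ≡⟨ cong code (encode-decode {N} d) ⟨
          code (encode {N} (decode d)) ∎))) ⟩
      encode {N} (decode d)        ≡⟨ encode-decode {N} d ⟩
      d                            ∎

    surjective-between : ∀ {k l} (f : Fin k → Fin l) → k ≡ l → Injective _≡_ _≡_ f → ∀ y → ∃ λ x → f x ≡ y
    surjective-between f refl = injective⇒surjective f

    -- `code` is an injection between sets of equal size q^(rn) = (q^n)^r, so x is the coordinate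
    -- tuple of some v, and `vec x` is that v. This amounts to the independence of the spanning
    -- elements.
    π-vec : ∀ a x → π a (vec x) ≡ x a
    π-vec a x =
      let c , eq = surjective-between code sizes code-injective (funToFin x)
          v = decode c
          πv≡x : ∀ b → π b v ≡ x b
          πv≡x b = trans (cong (λ w → finToFun (code w) b) (encode-decode {N} c))
                     (trans (cong (λ w → finToFun w b) eq) (Fin.finToFun-funToFin x b))
      in trans (π-cong a (≈-trans (Φ-cong (λ b i → cong (λ w → decode w i) (sym (πv≡x b)))) (Φ-π v))) (πv≡x a)

    π-determined : ∀ {v x} → v ≈ vec x → ∀ a → π a v ≡ x a
    π-determined v≈ a = trans (π-cong a v≈) (π-vec a _)

    coordinates : Coordinates S e
    coordinates = record
      { π = π
      ; π-cong = π-cong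
      ; π-+ = λ a u v → π-determined
          (≈-trans (λ i → sym (cong₂ _+_ (Φ-π u i) (Φ-π v i)))
          (≈-trans (≈-sym (Φ-+ (λ a → decode (π a u)) (λ a → decode (π a v))))
            (Φ-cong (λ a → ≈-sym (decode-encode (decode (π a u) +v decode (π a v))))))) a
      ; π-· = λ a c v → π-determined
          (≈-trans (λ i → sym (cong (c *_) (Φ-π v i)))
          (≈-trans (≈-sym (Φ-· c (λ a → decode (π a v))))
            (Φ-cong (λ a → ≈-sym (decode-encode (c · decode (π a v))))))) a
      ; π-ext = π-ext
      ; vec = vec
      ; π-vec = π-vec
      ; axis⇒ = axis⇒
      ; axis⇐ = λ {a} {v} off → span-resp
          (≈-trans (≈-sym (Φ-single (λ b → decode (π b v)) a
            (λ b b≢a → λ i → trans (cong (λ w → decode w i) (off b b≢a)) (decode-encode {n} 0v i)))) (Φ-π v))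
          (lincomb∈ n (decode (π a v)) (basis (e a)) span-gen)
      }
      where
      axis⇒ : ∀ {a v} → InSpan (basis (e a)) v → ∀ b → b ≢ a → π b v ≡ 𝟘
      axis⇒ {a} {v} v∈ b b≢a =
        let c , v≈ = span⇒lincomb v∈
            C : Fin r → Vect n
            C d l = δ a d * c l
        in trans (π-determined {v} {λ d → encode (C d)}
             (≈-trans v≈ (≈-trans (lincomb-cong n (basis (e a)) (λ l → sym (trans (cong (_* c l) (δ-diag a)) (*-identityˡ _))))
             (≈-trans (≈-sym (Φ-single C a (λ d d≢a l → trans (cong (_* c l) (δ-off (d≢a ∘ sym))) (zeroˡ _))))
               (Φ-cong (λ d → ≈-sym (decode-encode (C d))))))) b)
             (encode-cong {n} (λ l → trans (cong (_* c l) (δ-off (b≢a ∘ sym))) (zeroˡ _)))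

-- Spread elements in coordinates

module Elements (F : Field) {q : ℕ} (order : HasOrder F q) {N n : ℕ} (S : Spread F N n) where
  open VectorSpace F
  open LinearAlgebra F order
  open CommutativeRing commutativeRing using (1#; 0#; -_; zeroˡ; -‿inverseʳ)
  open import Algebra.Properties.Ring (CommutativeRing.ring commutativeRing) using (-1*x≈-x; +-inverseˡ-unique; -‿involutive)
  open Spread S
  open Codes n

  𝕎 : AbelianGroup 0ℓ 0ℓ
  𝕎 = record { isAbelianGroup = ⊕-isAbelianGroup }

  open AbelianGroup 𝕎 using (identityˡ; identityʳ; inverseʳ; comm)
  open import Algebra.Properties.AbelianGroup 𝕎
    using (inverseˡ-unique; inverseʳ-unique; ⁻¹-involutive; ε⁻¹≈ε; x∙y⁻¹≈ε⇒x≈y)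
  open ≡-Reasoning

  infix 4 _∋_
  _∋_ : Index → Vect N → Set
  k ∋ v = InSpan (basis k) v

  span-neg : ∀ {k v} → k ∋ v → k ∋ ((- 1#) · v)
  span-neg = span-· (- 1#)

  -- The working form of normality: by disjointness the element that it provides through v is k, so
  -- all of k lies in the join.
  split : ∀ {i j k u w v x} → Normal S i → j ≢ i → i ∋ u → j ∋ w → k ∋ v → NonZero v → v ≈ (u +v w) → k ∋ x →
          ∃₂ λ u′ w′ → i ∋ u′ × j ∋ w′ × x ≈ (u′ +v w′)
  split {j = j} {v = v} normal j≢i u∈ w∈ v∈ nz v≈ x∈ =
    let k′ , v∈k′ , k′⊆ = normal j j≢i v nz (span-resp (≈-sym v≈)
          (span-+ (span-mono (span-gen ∘ inj₁) u∈) (span-mono (span-gen ∘ inj₂) w∈)))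
    in span-join (k′⊆ _ (subst (_∋ _) (disjoint _ k′ v nz v∈ v∈k′) x∈))

  basis-nonzero : ∀ k (l : Fin n) → NonZero (basis k l)
  basis-nonzero k l = decidable-stable (nonzero? (basis k l)) (λ ¬nz → Field.0≢1 F (trans
    (sym (indep k (δ l) (≈-trans (lincomb-δ n l (basis k)) (¬nonzero⇒≈0 ¬nz)) l)) (δ-diag l)))

  -- Coordinate projections of spread elements

  module InCoordinates {r : ℕ} {e : Fin r → Index} (coords : Coordinates F order S e) (e-normal : ∀ a → Normal S (e a)) where
    open Coordinates coords public

    π-0 : ∀ {v} → v ≈ 0v → ∀ a → π a v ≡ 𝟘
    π-0 {v} v≈0 a = trans (π-cong a (λ i → trans (v≈0 i) (sym (zeroˡ 0#)))) (trans (π-· a 0# 0v) (⊙-zeroˡ _))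

    π-neg : ∀ a v → π a ((- 1#) · v) ≡ ⊖ π a v
    π-neg a v = trans (π-· a (- 1#) v) (⊙-neg _)

    nonzero-at : ∀ {a v} → π a v ≢ 𝟘 → NonZero v
    nonzero-at {a} {v} πv≢0 = decidable-stable (nonzero? v) (λ ¬nz → πv≢0 (π-0 (¬nonzero⇒≈0 ¬nz) a))

    nonzero-coordinate : ∀ {v} → NonZero v → ∃ λ a → π a v ≢ 𝟘
    nonzero-coordinate {v} (i , vi≢0) = decidable-stable (Fin.any? (λ a → ¬? (π a v Fin.≟ 𝟘))) (λ none →
      vi≢0 (π-ext {v} {0v} (λ a → trans (decidable-stable (π a v Fin.≟ 𝟘) (λ ≢0 → none (a , ≢0))) (sym (π-0 (λ _ → refl) a))) i))

    distinct : ∀ {a b v} → π a v ≢ 𝟘 → π b v ≡ 𝟘 → a ≢ b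
    distinct πav≢0 πbv≡0 refl = πav≢0 πbv≡0

    restrict : {A : Fin r → Set} → Decidable A → Vect N → Vect N
    restrict A? v = vec (λ d → choose (A? d) (π d v) 𝟘)

    restrict-in : ∀ {A : Fin r → Set} (A? : Decidable A) v {d} → A d → π d (restrict A? v) ≡ π d v
    restrict-in A? v {d} Ad = trans (π-vec d _) (choose-yes (A? d) Ad)

    restrict-out : ∀ {A : Fin r → Set} (A? : Decidable A) v {d} → ¬ A d → π d (restrict A? v) ≡ 𝟘
    restrict-out A? v {d} ¬Ad = trans (π-vec d _) (choose-no (A? d) ¬Ad)

    restrict-cong : ∀ {A : Fin r → Set} (A? : Decidable A) {u v} →
                    (∀ {d} → A d → π d u ≡ π d v) → restrict A? u ≈ restrict A? v
    restrict-cong A? {u} {v} eq = π-ext (λ d → helper d (A? d))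
      where
      helper : ∀ d → Dec _ → π d (restrict A? u) ≡ π d (restrict A? v)
      helper d (yes Ad) = trans (restrict-in A? u Ad) (trans (eq Ad) (sym (restrict-in A? v Ad)))
      helper d (no ¬Ad) = trans (restrict-out A? u ¬Ad) (sym (restrict-out A? v ¬Ad))

    restrict-all : ∀ {A : Fin r → Set} (A? : Decidable A) {v} → (∀ {d} → ¬ A d → π d v ≡ 𝟘) → restrict A? v ≈ v
    restrict-all A? {v} off = π-ext (λ d → helper d (A? d))
      where
      helper : ∀ d → Dec _ → π d (restrict A? v) ≡ π d v
      helper d (yes Ad) = restrict-in A? v Ad
      helper d (no ¬Ad) = trans (restrict-out A? v ¬Ad) (sym (off ¬Ad))

    erase? : (c d : Fin r) → Dec (d ≢ c)
    erase? c d = ¬? (d Fin.≟ c)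

    erase only : Fin r → Vect N → Vect N
    erase c = restrict (erase? c)
    only c = restrict (Fin._≟ c)

    erase-at : ∀ c v → π c (erase c v) ≡ 𝟘
    erase-at c v = restrict-out (erase? c) v (λ c≢c → c≢c refl)

    only∈axis : ∀ c v → e c ∋ only c v
    only∈axis c v = axis⇐ (λ d d≢c → restrict-out (Fin._≟ c) v d≢c)

    only+erase : ∀ c v → v ≈ (only c v +v erase c v)
    only+erase c v = π-ext (λ d → sym (trans (π-+ d _ _) (helper d (d Fin.≟ c))))
      where
      helper : ∀ d → Dec (d ≡ c) → π d (only c v) ⊕ π d (erase c v) ≡ π d v
      helper d (yes refl) = trans (cong₂ _⊕_ (restrict-in (Fin._≟ c) v refl) (erase-at c v)) (identityʳ _)
      helper d (no d≢c) = trans (cong₂ _⊕_ (restrict-out (Fin._≟ c) v d≢c) (restrict-in (erase? c) v d≢c)) (identityˡ _)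

    erase-nonzero⇒≢axis : ∀ {k c v} → NonZero (erase c v) → k ∋ erase c v → k ≢ e c
    erase-nonzero⇒≢axis {c = c} {v} nz v°∈ refl =
      let d , ≢0 = nonzero-coordinate nz
      in ≢0 (axis⇒ v°∈ d (distinct ≢0 (erase-at c v)))

    support? : ∀ v d → Dec (π d v ≢ 𝟘)
    support? v d = ¬? (π d v Fin.≟ 𝟘)

    erase-support : ∀ {c v d} → π d (erase c v) ≢ 𝟘 → π d v ≢ 𝟘
    erase-support {c} {v} {d} ≢0 πdv≡0 = ≢0 (helper (d Fin.≟ c))
      where
      helper : Dec (d ≡ c) → π d (erase c v) ≡ 𝟘
      helper (yes refl) = erase-at c v
      helper (no d≢c) = trans (restrict-in (erase? c) v d≢c) πdv≡0

    -- Peel off a coordinate c from the support of v. By normality of `e c`, x splits along `e c`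
    -- and the element through `erase c v`: the first part vanishes at b because b ≠ c, the second
    -- by induction. If nothing remains after erasing, k is the axis `e c`.
    vanish-acc : ∀ {k v x b} → Acc ℕ._<_ (count (support? v)) →
                 k ∋ v → NonZero v → π b v ≡ 𝟘 → k ∋ x → π b x ≡ 𝟘
    vanish-acc {k} {v} {x} {b} (acc rec) v∈ nz πbv≡0 x∈ = helper (nonzero? (erase c v))
      where
      c = proj₁ (nonzero-coordinate nz)
      πcv≢0 = proj₂ (nonzero-coordinate nz)
      b≢c : b ≢ c
      b≢c = distinct πcv≢0 πbv≡0 ∘ sym
      helper : Dec (NonZero (erase c v)) → π b x ≡ 𝟘
      helper (no ¬nz) = axis⇒ (subst (_∋ x) (disjoint k (e c) v nz v∈ (axis⇐ (λ d d≢c →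
        trans (sym (restrict-in (erase? c) v d≢c)) (π-0 (¬nonzero⇒≈0 ¬nz) d)))) x∈) b b≢c
      helper (yes nz°) =
        let k° , v°∈ = covers (erase c v) nz°
            u′ , w′ , u′∈ , w′∈ , x≈ = split (e-normal c) (erase-nonzero⇒≢axis nz° v°∈)
                                         (only∈axis c v) v°∈ v∈ nz (only+erase c v) x∈
            πbw′≡0 = vanish-acc (rec (count-mono-< (support? (erase c v)) (support? v)
                         (λ d → erase-support) c πcv≢0 (λ ≢0 → ≢0 (erase-at c v))))
                       v°∈ nz° (trans (restrict-in (erase? c) v b≢c) πbv≡0) w′∈
        in trans (π-cong b x≈) (trans (π-+ b u′ w′) (trans (cong₂ _⊕_ (axis⇒ u′∈ b b≢c) πbw′≡0) (identityʳ _)))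

    vanish : ∀ {k v x b} → k ∋ v → NonZero v → π b v ≡ 𝟘 → k ∋ x → π b x ≡ 𝟘
    vanish = vanish-acc (ℕ.<-wellFounded _)

    -- The difference of x and x′ vanishes at a. Were it nonzero, `vanish` would make all of k
    -- vanish there, including v.
    determined : ∀ {k v a x x′} → k ∋ v → π a v ≢ 𝟘 → k ∋ x → k ∋ x′ → π a x ≡ π a x′ → x ≈ x′
    determined {k} {v} {a} {x} {x′} v∈ πav≢0 x∈ x′∈ eq = π-ext (λ d → x∙y⁻¹≈ε⇒x≈y _ _ (trans (sym (π-z d)) (π-0 (¬nonzero⇒≈0 ¬nz) d)))
      where
      z : Vect N
      z = x +v ((- 1#) · x′)
      π-z : ∀ d → π d z ≡ π d x ⊕ ⊖ π d x′
      π-z d = trans (π-+ d x _) (cong (π d x ⊕_) (π-neg d x′))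
      ¬nz : ¬ NonZero z
      ¬nz nz = πav≢0 (vanish (span-+ x∈ (span-neg x′∈)) nz
        (trans (π-z a) (trans (cong (_⊕ ⊖ π a x′) eq) (inverseʳ _))) v∈)

    abstract
      -- By `determined`, projection to coordinate a is injective on the q^n vectors of k, hence
      -- onto W.
      lift : ∀ {k v a} → k ∋ v → π a v ≢ 𝟘 → ∀ w → ∃ λ x → k ∋ x × π a x ≡ w
      lift {k} {v} {a} v∈ πav≢0 w =
        let c , eq = injective⇒surjective (λ c → π a (point c)) injective w in point c , point∈ c , eq
        where
        point : W → Vect N
        point c = lincomb n (decode c) (basis k)
        point∈ : ∀ c → k ∋ point c
        point∈ c = lincomb∈ n (decode c) (basis k) span-gen
        injective : Injective _≡_ _≡_ (λ c → π a (point c))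
        injective {c} {d} eq = decode-injective {n} (λ l → trans (+-inverseˡ-unique _ _
            (indep k (decode c +v ((- 1#) · decode d)) (λ i → trans (lincomb-+ n (decode c) _ (basis k) i)
              (trans (cong₂ _+′_ (determined v∈ πav≢0 (point∈ c) (point∈ d) eq i) (lincomb-· n (- 1#) (decode d) (basis k) i))
                (trans (cong (point d i +′_) (-1*x≈-x (point d i))) (-‿inverseʳ (point d i))))) l))
            (trans (cong -_ (-1*x≈-x _)) (-‿involutive _)))
          where
          open CommutativeRing commutativeRing using () renaming (_+_ to _+′_)

    erase-split : ∀ c v → erase c v ≈ (((- 1#) · only c v) +v v)
    erase-split c v = π-ext (λ d → sym (trans (π-+ d _ v) (trans (cong₂ _⊕_ (π-neg d (only c v)) (trans (π-cong d (only+erase c v)) (π-+ d _ _)))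
      (\\-leftDividesʳ (π d (only c v)) (π d (erase c v))))))
      where open import Algebra.Properties.Group (AbelianGroup.group 𝕎) using (\\-leftDividesʳ)

    -- The element k° lies in ⟨e c, k⟩ by normality. Take x′ in k° with the a-coordinate of x. Its
    -- component in k agrees with it off c, so that component is x by `determined`; and x′ vanishes
    -- at c because `erase c v` does. Hence x′ is `erase c x`.
    erase∈ : ∀ {k k° c v x} → k ∋ v → NonZero (erase c v) → k° ∋ erase c v → k ∋ x → k° ∋ erase c x
    erase∈ {k} {k°} {c} {v} {x} v∈ nz° v°∈ x∈ = at (nonzero-coordinate nz°)
      where
      agree : ∀ {x′ w′} → (∀ d → d ≢ c → π d x′ ≡ π d w′) → w′ ≈ x → π c x′ ≡ 𝟘 → ∀ d → Dec (d ≡ c) → π d x′ ≡ π d (erase c x)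
      agree off-c w′≈x at-c d (yes refl) = trans at-c (sym (erase-at d x))
      agree off-c w′≈x at-c d (no d≢c) = trans (off-c d d≢c) (trans (π-cong d w′≈x) (sym (restrict-in (erase? c) x d≢c)))
      module _ {a} (πav°≢0 : π a (erase c v) ≢ 𝟘) where
        a≢c : a ≢ c
        a≢c = distinct πav°≢0 (erase-at c v)
        πav≢0 : π a v ≢ 𝟘
        πav≢0 = erase-support {c} {v} πav°≢0
        glue : ∀ {x′} → k° ∋ x′ → π a x′ ≡ π a x → (∃₂ λ u′ w′ → e c ∋ u′ × k ∋ w′ × x′ ≈ (u′ +v w′)) → k° ∋ erase c x
        glue {x′} x′∈ πax′ (u′ , w′ , u′∈ , w′∈ , x′≈) = span-resp
          (π-ext (λ d → agree off-c (determined v∈ πav≢0 w′∈ x∈ (trans (sym (off-c a a≢c)) πax′))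
            (vanish v°∈ nz° (erase-at c v) x′∈) d (d Fin.≟ c))) x′∈
          where
          off-c : ∀ d → d ≢ c → π d x′ ≡ π d w′
          off-c d d≢c = trans (π-cong d x′≈) (trans (π-+ d u′ w′) (trans (cong (_⊕ π d w′) (axis⇒ u′∈ d d≢c)) (identityˡ _)))
      at : (∃ λ a → π a (erase c v) ≢ 𝟘) → k° ∋ erase c x
      at (a , πav°≢0) = let x′ , x′∈ , πax′ = lift v°∈ πav°≢0 (π a x) in
        glue πav°≢0 x′∈ πax′ (split (e-normal c)
          (λ k≡ec → πav≢0 πav°≢0 (axis⇒ (subst (_∋ v) k≡ec v∈) a (a≢c πav°≢0)))
          (span-neg (only∈axis c v)) v∈ v°∈ nz° (erase-split c v) x′∈)

    module _ {A : Fin r → Set} (A? : Decidable A) where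
      outside? : ∀ v d → Dec (¬ A d × π d v ≢ 𝟘)
      outside? v d = ¬? (A? d) ×-dec support? v d

      -- Erase one by one the coordinates outside `A` at which v is nonzero; where v vanishes, so
      -- does all of k.
      restrict∈-acc : ∀ {k k′ v x a} → Acc ℕ._<_ (count (outside? v)) →
                      k ∋ v → A a → π a v ≢ 𝟘 → k′ ∋ restrict A? v → k ∋ x → k′ ∋ restrict A? x
      restrict∈-acc {k} {k′} {v} {x} {a} (acc rec) v∈ Aa πav≢0 v′∈ x∈ = helper (Fin.any? (outside? v))
        where
        nz = nonzero-at πav≢0
        helper : Dec (∃ λ d → ¬ A d × π d v ≢ 𝟘) → k′ ∋ restrict A? x
        helper (no none) = span-resp (≈-sym (restrict-all A? (λ {d} ¬Ad → vanish v∈ nz (off ¬Ad) x∈)))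
          (subst (_∋ x) (disjoint k k′ v nz v∈ (span-resp (restrict-all A? off) v′∈)) x∈)
          where
          off : ∀ {d} → ¬ A d → π d v ≡ 𝟘
          off {d} ¬Ad = decidable-stable (π d v Fin.≟ 𝟘) (λ ≢0 → none (d , ¬Ad , ≢0))
        helper (yes (c , ¬Ac , πcv≢0)) =
          let πav°≢0 = λ eq → πav≢0 (trans (sym (kept v Aa)) eq)
              k° , v°∈ = covers (erase c v) (nonzero-at πav°≢0)
          in span-resp (restrict-cong A? (kept x))
               (restrict∈-acc (rec (count-mono-< (outside? (erase c v)) (outside? v)
                   (λ d (¬Ad , ≢0) → ¬Ad , erase-support ≢0) c (¬Ac , πcv≢0) (λ (_ , ≢0) → ≢0 (erase-at c v))))
                 v°∈ Aa πav°≢0 (span-resp (≈-sym (restrict-cong A? (kept v))) v′∈)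
                 (erase∈ v∈ (nonzero-at πav°≢0) v°∈ x∈))
          where
          kept : ∀ y {d} → A d → π d (erase c y) ≡ π d y
          kept y Ad = restrict-in (erase? c) y (λ { refl → ¬Ac Ad })

      restrict∈ : ∀ {k k′ v x a} → k ∋ v → A a → π a v ≢ 𝟘 → k′ ∋ restrict A? v → k ∋ x → k′ ∋ restrict A? x
      restrict∈ = restrict∈-acc (ℕ.<-wellFounded _)

    -- Rescaling an element to the diagonal

    module Normalisation (o : Fin r) {U : Index} {u : Vect N} (u∈ : U ∋ u) (full : ∀ a → π a u ≢ 𝟘) where
      ℓ : Fin r → W → Vect N
      ℓ a w = proj₁ (lift u∈ (full a) w)

      ℓ∈ : ∀ a w → U ∋ ℓ a w
      ℓ∈ a w = proj₁ (proj₂ (lift u∈ (full a) w))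

      π-ℓ : ∀ a w → π a (ℓ a w) ≡ w
      π-ℓ a w = proj₂ (proj₂ (lift u∈ (full a) w))

      ℓ-unique : ∀ a {w x} → U ∋ x → π a x ≡ w → ℓ a w ≈ x
      ℓ-unique a {w} x∈ eq = determined u∈ (full a) (ℓ∈ a w) x∈ (trans (π-ℓ a w) (sym eq))

      ℓ-injective : ∀ a {w w′} → π o (ℓ a w) ≡ π o (ℓ a w′) → w ≡ w′
      ℓ-injective a {w} {w′} eq = trans (sym (π-ℓ a w))
        (trans (π-cong a (determined u∈ (full o) (ℓ∈ a w) (ℓ∈ a w′) eq)) (π-ℓ a w′))

      -- `U` is the graph of a bijection between any two coordinates, and each coordinate is carried
      -- to coordinate o along it. On `U` itself the new coordinates all agree.
      rescale : Fin r → Vect N → W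
      rescale a v = π o (ℓ a (π a v))

      rescale-local : ∀ {a v v′} → π a v ≡ π a v′ → rescale a v ≡ rescale a v′
      rescale-local {a} = cong (λ w → π o (ℓ a w))

      rescale-diagonal : ∀ {x} → U ∋ x → ∀ a → rescale a x ≡ π o x
      rescale-diagonal x∈ a = π-cong o (ℓ-unique a x∈ refl)

      rescale-zero : ∀ {a v} → π a v ≡ 𝟘 → rescale a v ≡ 𝟘
      rescale-zero {a} {v} πav≡0 =
        trans (π-cong o (ℓ-unique a span-0 (trans (π-0 (λ _ → refl) a) (sym πav≡0)))) (π-0 (λ _ → refl) o)

      rescale-zero⁻¹ : ∀ {a v} → rescale a v ≡ 𝟘 → π a v ≡ 𝟘
      rescale-zero⁻¹ {a} {v} eq = trans (ℓ-injective a (trans eq (sym (rescale-zero {v = 0v} (π-0 (λ _ → refl) a))))) (π-0 {0v} (λ _ → refl) a)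

      rescaled : Coordinates F order S e
      rescaled = record
        { π = rescale
        ; π-cong = λ a {u} {v} u≈v → rescale-local {a} {u} {v} (π-cong a u≈v)
        ; π-+ = λ a x y → trans (π-cong o (ℓ-unique a (span-+ (ℓ∈ a _) (ℓ∈ a _))
            (trans (π-+ a _ _) (trans (cong₂ _⊕_ (π-ℓ a _) (π-ℓ a _)) (sym (π-+ a x y)))))) (π-+ o _ _)
        ; π-· = λ a c x → trans (π-cong o (ℓ-unique a (span-· c (ℓ∈ a _))
            (trans (π-· a c _) (trans (cong (c ⊙_) (π-ℓ a _)) (sym (π-· a c x)))))) (π-· o c _)
        ; π-ext = λ {u} {v} eq → π-ext (λ a → ℓ-injective a {π a u} {π a v} (eq a))
        ; vec = λ x → vec (λ a → π a (ℓ o (x a)))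
        ; π-vec = λ a x → trans (π-cong o (ℓ-unique a (ℓ∈ o (x a)) (sym (π-vec a _)))) (π-ℓ o (x a))
        ; axis⇒ = λ {a} {v} v∈ b b≢a → rescale-zero {b} {v} (axis⇒ v∈ b b≢a)
        ; axis⇐ = λ off → axis⇐ (λ b b≢a → rescale-zero⁻¹ {b} (off b b≢a))
        }

    -- The nearfield of slopes

    module Nearfield {o p : Fin r} (p≢o : p ≢ o) (third : ∀ (a b : Fin r) → ∃ λ c → c ≢ a × c ≢ b)
      {U : Index} {u : Vect N} (u∈ : U ∋ u) (πou≢0 : π o u ≢ 𝟘)
      (diagonal : ∀ {x} → U ∋ x → ∀ a → π a x ≡ π o x) where

      𝟙 : W
      𝟙 = π o u

      diag : W → Vect N
      diag w = vec (λ _ → w)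

      diag∈ : ∀ w → U ∋ diag w
      diag∈ w = let x , x∈ , πox = lift u∈ πou≢0 w in
        span-resp (π-ext (λ a → trans (diagonal x∈ a) (trans πox (sym (π-vec a _))))) x∈

      -- Restriction to the coordinates a and b sends both elements into the one through the common
      -- restricted point, where coordinate a determines the vector.
      unique : ∀ {a b k k′ v v′ x x′} → k ∋ v → k ∋ x → k′ ∋ v′ → k′ ∋ x′ →
               π a v ≢ 𝟘 → π a v ≡ π a v′ → π b v ≡ π b v′ → π a x ≡ π a x′ → π b x ≡ π b x′
      unique {a} {b} {k} {k′} {v} {v′} {x} {x′} v∈ x∈ v′∈ x′∈ πav≢0 eqa eqb eqx =
        let πaA = λ eq → πav≢0 (trans (sym (restrict-in A? v a∈A)) eq)
            k″ , v″∈ = covers (restrict A? v) (nonzero-at πaA)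
            x≈ = determined v″∈ πaA (restrict∈ A? v∈ a∈A πav≢0 v″∈ x∈)
                   (restrict∈ A? v′∈ a∈A (λ eq → πav≢0 (trans eqa eq)) (span-resp v≈ v″∈) x′∈)
                   (trans (restrict-in A? x a∈A) (trans eqx (sym (restrict-in A? x′ a∈A))))
        in trans (sym (restrict-in A? x b∈A)) (trans (π-cong b x≈) (restrict-in A? x′ b∈A))
        where
        A : Fin r → Set
        A d = d ≡ a ⊎ d ≡ b
        A? : Decidable A
        A? d = (d Fin.≟ a) ⊎-dec (d Fin.≟ b)
        a∈A : A a
        a∈A = inj₁ refl
        b∈A : A b
        b∈A = inj₂ refl
        v≈ : restrict A? v ≈ restrict A? v′
        v≈ = restrict-cong A? (λ { (inj₁ refl) → eqa ; (inj₂ refl) → eqb })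

      -- If the common value is nonzero, k has the same slope from b to c as the diagonal.
      same : ∀ {k v x b c} → k ∋ v → NonZero v → π b v ≡ π c v → k ∋ x → π b x ≡ π c x
      same {k} {v} {x} {b} {c} v∈ nz eq x∈ = helper (π b v Fin.≟ 𝟘)
        where
        helper : Dec (π b v ≡ 𝟘) → π b x ≡ π c x
        helper (yes πbv≡0) = trans (vanish v∈ nz πbv≡0 x∈) (sym (vanish v∈ nz (trans (sym eq) πbv≡0) x∈))
        helper (no πbv≢0) = sym (trans
          (unique v∈ x∈ (diag∈ (π b v)) (diag∈ (π b x)) πbv≢0
            (sym (π-vec b _)) (trans (sym eq) (sym (π-vec c _))) (sym (π-vec b _))) (π-vec c _))

      spike : Fin r → W → W → Vect N
      spike a w z = vec (λ d → choose (d Fin.≟ a) w z)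

      spike-at : ∀ a {w z} → π a (spike a w z) ≡ w
      spike-at a = trans (π-vec a _) (choose-yes (a Fin.≟ a) refl)

      spike-off : ∀ {a d w z} → d ≢ a → π d (spike a w z) ≡ z
      spike-off {a} {d} d≢a = trans (π-vec d _) (choose-no (d Fin.≟ a) d≢a)

      module _ {a v} (πav≢0 : π a v ≢ 𝟘) (w : W) where
        through : Index
        through = proj₁ (covers v (nonzero-at πav≢0))

        through∋ : through ∋ v
        through∋ = proj₂ (covers v (nonzero-at πav≢0))

        move : Vect N
        move = proj₁ (lift through∋ πav≢0 w)

        move∈ : through ∋ move
        move∈ = proj₁ (proj₂ (lift through∋ πav≢0 w))

        π-move : π a move ≡ w
        π-move = proj₂ (proj₂ (lift through∋ πav≢0 w))

      at-one : ∀ {a v} → π a v ≡ 𝟙 → π a v ≢ 𝟘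
      at-one eq eq′ = πou≢0 (trans (sym eq) eq′)

      infixl 7 _⊛_
      -- Right multiplication by z is the slope from o to p of the elements through a point with
      -- coordinates 𝟙 and z there. By `unique` any filling of the other coordinates gives the same
      -- slope.
      _⊛_ : W → W → W
      x ⊛ z = π p (move (at-one {v = spike o 𝟙 z} (spike-at o)) x)

      Multiplicative : Fin r → Fin r → Set
      Multiplicative a b = ∀ {k v x} → k ∋ v → k ∋ x → π a v ≡ 𝟙 → π b x ≡ π a x ⊛ π b v

      multiplicative-op : Multiplicative o p
      multiplicative-op {v = v} {x} v∈ x∈ πov≡1 =
        unique v∈ x∈ (through∋ nz (π o x)) (move∈ nz (π o x)) (at-one πov≡1) (trans πov≡1 (sym (spike-at o)))
          (sym (spike-off p≢o)) (sym (π-move nz (π o x)))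
        where nz = at-one {v = spike o 𝟙 (π p v)} (spike-at o)

      -- The spike keeps the coordinates of v at a and c and makes those at b and c coincide; `same`
      -- extends this equality to its whole element.
      multiplicativeʳ : ∀ {a b c} → b ≢ a → c ≢ a → Multiplicative a b → Multiplicative a c
      multiplicativeʳ {a} {b} {c} b≢a c≢a mult {k} {v} {x} v∈ x∈ πav≡1 = begin
        π c x                      ≡⟨ unique v∈ x∈ v′∈ x′∈ (at-one πav≡1) (trans πav≡1 (sym (spike-at a)))
                                        (sym (spike-off c≢a)) (sym (π-move nz (π a x))) ⟩
        π c x′                     ≡⟨ same v′∈ (nonzero-at nz) (trans (spike-off b≢a) (sym (spike-off c≢a))) x′∈ ⟨
        π b x′                     ≡⟨ mult v′∈ x′∈ (spike-at a) ⟩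
        π a x′ ⊛ π b v′            ≡⟨ cong₂ _⊛_ (π-move nz (π a x)) (spike-off b≢a) ⟩
        π a x ⊛ π c v              ∎
        where
        v′ = spike a 𝟙 (π c v)
        nz : π a v′ ≢ 𝟘
        nz = at-one (spike-at a)
        v′∈ = through∋ nz (π a x)
        x′ = move nz (π a x)
        x′∈ = move∈ nz (π a x)

      multiplicativeˡ : ∀ {a b c} → a ≢ b → c ≢ b → Multiplicative a b → Multiplicative c b
      multiplicativeˡ {a} {b} {c} a≢b c≢b mult {k} {v} {x} v∈ x∈ πcv≡1 = begin
        π b x                      ≡⟨ unique v∈ x∈ v′∈ x′∈ (at-one πcv≡1) (trans πcv≡1 (sym (spike-off c≢b)))
                                        (sym (spike-at b)) (sym (π-move nz (π c x))) ⟩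
        π b x′                     ≡⟨ mult v′∈ x′∈ (spike-off a≢b) ⟩
        π a x′ ⊛ π b v′            ≡⟨ cong₂ _⊛_ (same v′∈ (nonzero-at nz) (trans (spike-off a≢b) (sym (spike-off c≢b))) x′∈) (spike-at b) ⟩
        π c x′ ⊛ π b v             ≡⟨ cong (_⊛ π b v) (π-move nz (π c x)) ⟩
        π c x ⊛ π b v              ∎
        where
        v′ = spike b (π b v) 𝟙
        nz : π c v′ ≢ 𝟘
        nz = at-one (spike-off c≢b)
        v′∈ = through∋ nz (π c x)
        x′ = move nz (π c x)
        x′∈ = move∈ nz (π c x)

      ⊛-identityʳ : ∀ x → x ⊛ 𝟙 ≡ x
      ⊛-identityʳ x = begin
        x ⊛ 𝟙                          ≡⟨ cong₂ _⊛_ (π-vec o _) (π-vec p _) ⟨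
        π o (diag x) ⊛ π p (diag 𝟙)    ≡⟨ multiplicative-op (diag∈ 𝟙) (diag∈ x) (π-vec o _) ⟨
        π p (diag x)                   ≡⟨ π-vec p _ ⟩
        x                              ∎

      multiplicative : ∀ a b → Multiplicative a b
      multiplicative a b = helper (a Fin.≟ b) (b Fin.≟ o)
        where
        helper : Dec (a ≡ b) → Dec (b ≡ o) → Multiplicative a b
        helper (yes refl) _ {x = x} v∈ x∈ πav≡1 = sym (trans (cong (π a x ⊛_) πav≡1) (⊛-identityʳ _))
        helper (no a≢b) (no b≢o) = multiplicativeˡ (b≢o ∘ sym) a≢b (multiplicativeʳ p≢o b≢o multiplicative-op)
        -- Index changes must keep source and target distinct, so o becomes the target only after a
        -- detour: (o, p), (o, c), (a, c), (a, o).
        helper (no a≢o) (yes refl) = let c , c≢a , c≢o = third a o in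
          multiplicativeʳ c≢a (a≢o ∘ sym) (multiplicativeˡ (c≢o ∘ sym) (c≢a ∘ sym)
            (multiplicativeʳ p≢o c≢o multiplicative-op))

      𝟙≢𝟘 : 𝟙 ≢ 𝟘
      𝟙≢𝟘 = πou≢0

      module _ (z : W) where
        s-at : π o (spike o 𝟙 z) ≡ 𝟙
        s-at = spike-at o

        s-off : π p (spike o 𝟙 z) ≡ z
        s-off = spike-off p≢o

        line : Index
        line = through (at-one s-at) 𝟙

        line∋ : line ∋ spike o 𝟙 z
        line∋ = through∋ (at-one s-at) 𝟙

        on-line : ∀ x → ∃ λ y → line ∋ y × π o y ≡ x
        on-line x = move (at-one s-at) x , move∈ (at-one s-at) x , π-move (at-one s-at) x

        π-line : ∀ {y} → line ∋ y → π p y ≡ π o y ⊛ z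
        π-line y∈ = trans (multiplicative-op line∋ y∈ s-at) (cong (_ ⊛_) s-off)

      ⊛-identityˡ : ∀ z → 𝟙 ⊛ z ≡ z
      ⊛-identityˡ z = trans (cong (_⊛ z) (sym (s-at z))) (trans (sym (π-line z (line∋ z))) (s-off z))

      -- Spread elements are subspaces, so slopes are additive. The other distributive law is the
      -- one that may fail in a nearfield.
      ⊛-distribʳ : ∀ z x y → (x ⊕ y) ⊛ z ≡ x ⊛ z ⊕ y ⊛ z
      ⊛-distribʳ z x y =
        let x′ , x′∈ , πx = on-line z x ; y′ , y′∈ , πy = on-line z y in begin
        (x ⊕ y) ⊛ z              ≡⟨ cong (_⊛ z) (trans (π-+ o x′ y′) (cong₂ _⊕_ πx πy)) ⟨
        π o (x′ +v y′) ⊛ z       ≡⟨ π-line z (span-+ x′∈ y′∈) ⟨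
        π p (x′ +v y′)           ≡⟨ π-+ p x′ y′ ⟩
        π p x′ ⊕ π p y′          ≡⟨ cong₂ _⊕_ (trans (π-line z x′∈) (cong (_⊛ z) πx)) (trans (π-line z y′∈) (cong (_⊛ z) πy)) ⟩
        x ⊛ z ⊕ y ⊛ z            ∎

      ⊙-⊛ : ∀ c x z → (c ⊙ x) ⊛ z ≡ c ⊙ (x ⊛ z)
      ⊙-⊛ c x z = let x′ , x′∈ , πx = on-line z x in begin
        (c ⊙ x) ⊛ z          ≡⟨ cong (_⊛ z) (trans (π-· o c x′) (cong (c ⊙_) πx)) ⟨
        π o (c · x′) ⊛ z     ≡⟨ π-line z (span-· c x′∈) ⟨
        π p (c · x′)         ≡⟨ π-· p c x′ ⟩
        c ⊙ π p x′           ≡⟨ cong (c ⊙_) (trans (π-line z x′∈) (cong (_⊛ z) πx)) ⟩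
        c ⊙ (x ⊛ z)          ∎

      ⊛-zeroˡ : ∀ z → 𝟘 ⊛ z ≡ 𝟘
      ⊛-zeroˡ z = trans (cong (_⊛ z) (sym (⊙-zeroˡ 𝟙))) (trans (⊙-⊛ 0# 𝟙 z) (⊙-zeroˡ _))

      ⊛-zeroʳ : ∀ x → x ⊛ 𝟘 ≡ 𝟘
      ⊛-zeroʳ x = let x′ , x′∈ , πx = on-line 𝟘 x in begin
        x ⊛ 𝟘       ≡⟨ cong (_⊛ 𝟘) πx ⟨
        π o x′ ⊛ 𝟘  ≡⟨ π-line 𝟘 x′∈ ⟨
        π p x′      ≡⟨ vanish (line∋ 𝟘) (nonzero-at (at-one (s-at 𝟘))) (s-off 𝟘) x′∈ ⟩
        𝟘           ∎

      ⊛-negˡ : ∀ x z → (⊖ x) ⊛ z ≡ ⊖ (x ⊛ z)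
      ⊛-negˡ x z = trans (cong (_⊛ z) (sym (⊙-neg x))) (trans (⊙-⊛ (- 1#) x z) (⊙-neg _))

      ⊛-inverse : ∀ y → y ≢ 𝟘 → ∃ λ t → t ⊛ y ≡ 𝟙
      ⊛-inverse y y≢0 =
        let x , x∈ , πx = lift (line∋ y) (λ eq → y≢0 (trans (sym (s-off y)) eq)) 𝟙 in
        π o x , trans (sym (π-line y x∈)) πx

      -- One spread element has a point with coordinates 𝟙, y, y ⊛ z at o, p, s. For its point with
      -- o-coordinate x, the s-coordinate is x ⊛ (y ⊛ z) read from o and (x ⊛ y) ⊛ z read from p.
      ⊛-assoc : ∀ x y z → (x ⊛ y) ⊛ z ≡ x ⊛ (y ⊛ z)
      ⊛-assoc x y z = helper (y Fin.≟ 𝟘)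
        where
        s = proj₁ (third o p)
        s≢o : s ≢ o
        s≢o = proj₁ (proj₂ (third o p))
        s≢p : s ≢ p
        s≢p = proj₂ (proj₂ (third o p))
        module _ (y≢0 : y ≢ 𝟘) where
          t : W
          t = proj₁ (⊛-inverse y y≢0)
          -- `Multiplicative` needs 𝟙 at the source index, so the element is entered through (t, 𝟙,
          -- z) with t ⊛ y = 𝟙; its point with p-coordinate y then has 𝟙 at o.
          v : Vect N
          v = vec (λ d → choose (d Fin.≟ o) t (choose (d Fin.≟ p) 𝟙 z))
          πov : π o v ≡ t
          πov = trans (π-vec o _) (choose-yes (o Fin.≟ o) refl)
          πpv : π p v ≡ 𝟙
          πpv = trans (π-vec p _) (trans (choose-no (p Fin.≟ o) p≢o) (choose-yes (p Fin.≟ p) refl))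
          πsv : π s v ≡ z
          πsv = trans (π-vec s _) (trans (choose-no (s Fin.≟ o) s≢o) (choose-no (s Fin.≟ p) s≢p))
          v∈ = through∋ (at-one πpv) y
          v′ = move (at-one πpv) y
          v′∈ = move∈ (at-one πpv) y
          πpv′ : π p v′ ≡ y
          πpv′ = π-move (at-one πpv) y
          πov′ : π o v′ ≡ 𝟙
          πov′ = let t′ , t′∈ , πt = on-line y t in trans
            (unique v∈ v′∈ t′∈ (line∋ y) (at-one πpv)
              (trans πpv (sym (trans (π-line y t′∈) (trans (cong (_⊛ y) πt) (proj₂ (⊛-inverse y y≢0))))))
              (trans πov (sym πt)) (trans πpv′ (sym (s-off y)))) (s-at y)
          nonzero-case : (∃ λ x′ → through (at-one πpv) y ∋ x′ × π o x′ ≡ x) → (x ⊛ y) ⊛ z ≡ x ⊛ (y ⊛ z)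
          nonzero-case (x′ , x′∈ , πox′) = begin
            (x ⊛ y) ⊛ z               ≡⟨ cong (λ w → w ⊛ z) (cong₂ _⊛_ πox′ πpv′) ⟨
            (π o x′ ⊛ π p v′) ⊛ z     ≡⟨ cong₂ _⊛_ (sym (multiplicative o p v′∈ x′∈ πov′)) (sym πsv) ⟩
            π p x′ ⊛ π s v            ≡⟨ multiplicative p s v∈ x′∈ πpv ⟨
            π s x′                    ≡⟨ multiplicative o s v′∈ x′∈ πov′ ⟩
            π o x′ ⊛ π s v′           ≡⟨ cong₂ _⊛_ πox′ (multiplicative p s v∈ v′∈ πpv) ⟩
            x ⊛ (π p v′ ⊛ π s v)      ≡⟨ cong (x ⊛_) (cong₂ _⊛_ πpv′ πsv) ⟩
            x ⊛ (y ⊛ z)               ∎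
        helper : Dec (y ≡ 𝟘) → (x ⊛ y) ⊛ z ≡ x ⊛ (y ⊛ z)
        helper (yes refl) = begin
          (x ⊛ 𝟘) ⊛ z ≡⟨ cong (_⊛ z) (⊛-zeroʳ x) ⟩
          𝟘 ⊛ z       ≡⟨ ⊛-zeroˡ z ⟩
          𝟘           ≡⟨ ⊛-zeroʳ x ⟨
          x ⊛ 𝟘       ≡⟨ cong (x ⊛_) (⊛-zeroˡ z) ⟨
          x ⊛ (𝟘 ⊛ z) ∎
        helper (no y≢0) = nonzero-case y≢0 (lift (v′∈ y≢0) (at-one (πov′ y≢0)) x)

      -- Right multiplication by −1 fixes x ⊛ (−1) ⊕ x, so this vanishes unless −1 = 1.
      ⊛-minus-one : ∀ x → x ⊛ (⊖ 𝟙) ≡ ⊖ x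
      ⊛-minus-one x = helper (y Fin.≟ 𝟘)
        where
        m y : W
        m = ⊖ 𝟙
        y = x ⊛ m ⊕ x
        m⊛ : ∀ z → m ⊛ z ≡ ⊖ z
        m⊛ z = trans (⊛-negˡ 𝟙 z) (cong ⊖_ (⊛-identityˡ z))
        y⊛m≡y : y ⊛ m ≡ y
        y⊛m≡y = begin
          (x ⊛ m ⊕ x) ⊛ m        ≡⟨ ⊛-distribʳ m (x ⊛ m) x ⟩
          x ⊛ m ⊛ m ⊕ x ⊛ m      ≡⟨ cong (_⊕ x ⊛ m) (begin
            x ⊛ m ⊛ m              ≡⟨ ⊛-assoc x m m ⟩
            x ⊛ (m ⊛ m)            ≡⟨ cong (x ⊛_) (trans (m⊛ m) (⁻¹-involutive 𝟙)) ⟩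
            x ⊛ 𝟙                  ≡⟨ ⊛-identityʳ x ⟩
            x                      ∎) ⟩
          x ⊕ x ⊛ m              ≡⟨ comm x (x ⊛ m) ⟩
          x ⊛ m ⊕ x              ∎
        helper : Dec (y ≡ 𝟘) → x ⊛ m ≡ ⊖ x
        helper (yes y≡0) = inverseˡ-unique (x ⊛ m) x y≡0
        helper (no y≢0) = begin
          x ⊛ m   ≡⟨ cong (x ⊛_) m≡1 ⟩
          x ⊛ 𝟙   ≡⟨ ⊛-identityʳ x ⟩
          x       ≡⟨ ⊛-identityˡ x ⟨
          𝟙 ⊛ x   ≡⟨ cong (_⊛ x) m≡1 ⟨
          m ⊛ x   ≡⟨ m⊛ x ⟩
          ⊖ x     ∎
          where
          t = proj₁ (⊛-inverse y y≢0)
          t⊛y = proj₂ (⊛-inverse y y≢0)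
          m≡1 : m ≡ 𝟙
          m≡1 = begin
            m            ≡⟨ ⊛-identityˡ m ⟨
            𝟙 ⊛ m        ≡⟨ cong (_⊛ m) t⊛y ⟨
            t ⊛ y ⊛ m    ≡⟨ ⊛-assoc t y m ⟩
            t ⊛ (y ⊛ m)  ≡⟨ cong (t ⊛_) y⊛m≡y ⟩
            t ⊛ y        ≡⟨ t⊛y ⟩
            𝟙            ∎

      ⊛-negʳ : ∀ x z → x ⊛ (⊖ z) ≡ ⊖ (x ⊛ z)
      ⊛-negʳ x z = begin
        x ⊛ (⊖ z)        ≡⟨ cong (λ w → x ⊛ (⊖ w)) (⊛-identityˡ z) ⟨
        x ⊛ (⊖ (𝟙 ⊛ z))  ≡⟨ cong (x ⊛_) (⊛-negˡ 𝟙 z) ⟨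
        x ⊛ ((⊖ 𝟙) ⊛ z)  ≡⟨ ⊛-assoc x (⊖ 𝟙) z ⟨
        x ⊛ (⊖ 𝟙) ⊛ z    ≡⟨ cong (_⊛ z) (⊛-minus-one x) ⟩
        (⊖ x) ⊛ z        ≡⟨ ⊛-negˡ x z ⟩
        ⊖ (x ⊛ z)        ∎

      -- The second distributive law and the field

      module Distributivity {E : Index} (E-normal : Normal S E) {a b : Fin r} (a≢b : a ≢ b)
        {g : Vect N} (g∈ : E ∋ g) (πag : π a g ≡ 𝟙) (πbg : π b g ≡ 𝟙) (πg : ∀ c → π c g ≡ 𝟘 ⊎ π c g ≡ 𝟙) where

        -- Normality of E is applied to ⟨E , G⟩ with G the spread element through f, at the point g − f.
        module _ (x z : W) where
          c : Fin r
          c = proj₁ (third a b)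

          c≢a : c ≢ a
          c≢a = proj₁ (proj₂ (third a b))

          c≢b : c ≢ b
          c≢b = proj₂ (proj₂ (third a b))

          -- At (a, b, c), f is (0, z, 1), so v is (1, 1 - z, -1) or (1, 1 - z, 0), according as g
          -- is 0 or 1 at c.
          f v : Vect N
          f = vec (λ d → choose (d Fin.≟ a) 𝟘 (choose (d Fin.≟ b) z 𝟙))
          v = g +v ((- 1#) · f)

          πaf : π a f ≡ 𝟘
          πaf = trans (π-vec a _) (choose-yes (a Fin.≟ a) refl)

          πbf : π b f ≡ z
          πbf = trans (π-vec b _) (trans (choose-no (b Fin.≟ a) (a≢b ∘ sym)) (choose-yes (b Fin.≟ b) refl))

          πcf : π c f ≡ 𝟙
          πcf = trans (π-vec c _) (trans (choose-no (c Fin.≟ a) c≢a) (choose-no (c Fin.≟ b) c≢b))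

          π-v : ∀ d → π d v ≡ π d g ⊕ ⊖ π d f
          π-v d = trans (π-+ d g _) (cong (π d g ⊕_) (π-neg d f))

          πav : π a v ≡ 𝟙
          πav = trans (π-v a) (trans (cong₂ (λ s t → s ⊕ ⊖ t) πag πaf) (trans (cong (𝟙 ⊕_) ε⁻¹≈ε) (identityʳ 𝟙)))

          g-nonzero : NonZero g
          g-nonzero = nonzero-at (at-one πag)

          f-nonzero : NonZero f
          f-nonzero = nonzero-at (at-one πcf)

          G : Index
          G = through (at-one πcf) 𝟘

          f∈ : G ∋ f
          f∈ = through∋ (at-one πcf) 𝟘

          G≢E : G ≢ E
          G≢E G≡E = at-one πag (vanish f∈ f-nonzero πaf (subst (_∋ g) (sym G≡E) g∈))

          -- If g vanishes at c, so does g′, and f′ contributes x ⊛ (-1). If g is 1 there, y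
          -- vanishes at c while g′ contributes x. Both cases give -x.
          third-coordinate : ∀ {k y g′ f′} → k ∋ v → k ∋ y → π a y ≡ x → E ∋ g′ → π a g′ ≡ x → G ∋ f′ →
                             π c y ≡ π c g′ ⊕ π c f′ → π c f′ ≡ ⊖ x
          third-coordinate {y = y} {g′} {f′} v∈ y∈ πay g′∈ πag′ f′∈ πcy = [ off , on ]′ (πg c)
            where
            πcv : ∀ {w} → π c g ≡ w → π c v ≡ w ⊕ ⊖ 𝟙
            πcv eq = trans (π-v c) (cong₂ (λ s t → s ⊕ ⊖ t) eq πcf)
            off : π c g ≡ 𝟘 → π c f′ ≡ ⊖ x
            off πcg≡0 = begin
              π c f′               ≡⟨ identityˡ _ ⟨
              𝟘 ⊕ π c f′           ≡⟨ cong (_⊕ π c f′) (vanish g∈ g-nonzero πcg≡0 g′∈) ⟨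
              π c g′ ⊕ π c f′      ≡⟨ πcy ⟨
              π c y                ≡⟨ multiplicative a c v∈ y∈ πav ⟩
              π a y ⊛ π c v        ≡⟨ cong₂ _⊛_ πay (trans (πcv πcg≡0) (identityˡ _)) ⟩
              x ⊛ (⊖ 𝟙)            ≡⟨ ⊛-minus-one x ⟩
              ⊖ x                  ∎
            on : π c g ≡ 𝟙 → π c f′ ≡ ⊖ x
            on πcg≡1 = inverseʳ-unique x (π c f′) (begin
              x ⊕ π c f′           ≡⟨ cong (_⊕ π c f′) (trans (sym πag′) (same g∈ g-nonzero (trans πag (sym πcg≡1)) g′∈)) ⟩
              π c g′ ⊕ π c f′      ≡⟨ πcy ⟨
              π c y                ≡⟨ vanish v∈ (nonzero-at (at-one πav)) (trans (πcv πcg≡1) (inverseʳ 𝟙)) y∈ ⟩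
              𝟘                    ∎)

          -- Compare b-coordinates: y has x ⊛ (1 - z), while g′ contributes x and f′ contributes
          -- (-x) ⊛ z.
          from-split : ∀ {k y} → k ∋ v → k ∋ y → π a y ≡ x →
                       (∃₂ λ g′ f′ → E ∋ g′ × G ∋ f′ × y ≈ (g′ +v f′)) → x ⊛ (𝟙 ⊕ ⊖ z) ≡ x ⊕ ⊖ (x ⊛ z)
          from-split {k} {y} v∈ y∈ πay (g′ , f′ , g′∈ , f′∈ , y≈) = begin
            x ⊛ (𝟙 ⊕ ⊖ z)          ≡⟨ cong₂ _⊛_ πay (trans (π-v b) (cong₂ (λ s t → s ⊕ ⊖ t) πbg πbf)) ⟨
            π a y ⊛ π b v          ≡⟨ multiplicative a b v∈ y∈ πav ⟨
            π b y                  ≡⟨ π-y b ⟩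
            π b g′ ⊕ π b f′        ≡⟨ cong₂ _⊕_ (trans (sym (same g∈ g-nonzero (trans πag (sym πbg)) g′∈)) πag′)
                                        (multiplicative c b f∈ f′∈ πcf) ⟩
            x ⊕ π c f′ ⊛ π b f     ≡⟨ cong (x ⊕_) (cong₂ _⊛_ (third-coordinate v∈ y∈ πay g′∈ πag′ f′∈ (π-y c)) πbf) ⟩
            x ⊕ (⊖ x) ⊛ z          ≡⟨ cong (x ⊕_) (⊛-negˡ x z) ⟩
            x ⊕ ⊖ (x ⊛ z)          ∎
            where
            π-y : ∀ d → π d y ≡ π d g′ ⊕ π d f′
            π-y d = trans (π-cong d y≈) (π-+ d g′ f′)
            πag′ : π a g′ ≡ x
            πag′ = begin
              π a g′            ≡⟨ identityʳ _ ⟨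
              π a g′ ⊕ 𝟘        ≡⟨ cong (π a g′ ⊕_) (vanish f∈ f-nonzero πaf f′∈) ⟨
              π a g′ ⊕ π a f′   ≡⟨ π-y a ⟨
              π a y             ≡⟨ πay ⟩
              x                 ∎

          ⊛-one-minus : x ⊛ (𝟙 ⊕ ⊖ z) ≡ x ⊕ ⊖ (x ⊛ z)
          ⊛-one-minus = from-split (through∋ nz x) (move∈ nz x) (π-move nz x)
            (split E-normal G≢E g∈ (span-neg f∈) (through∋ nz x) (nonzero-at nz) (λ _ → refl) (move∈ nz x))
            where nz = at-one πav

        ⊛-one-plus : ∀ x z → x ⊛ (𝟙 ⊕ z) ≡ x ⊕ x ⊛ z
        ⊛-one-plus x z = begin
          x ⊛ (𝟙 ⊕ z)          ≡⟨ cong (λ w → x ⊛ (𝟙 ⊕ w)) (⁻¹-involutive z) ⟨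
          x ⊛ (𝟙 ⊕ ⊖ (⊖ z))    ≡⟨ ⊛-one-minus x (⊖ z) ⟩
          x ⊕ ⊖ (x ⊛ (⊖ z))    ≡⟨ cong (λ w → x ⊕ ⊖ w) (⊛-negʳ x z) ⟩
          x ⊕ ⊖ (⊖ (x ⊛ z))    ≡⟨ cong (x ⊕_) (⁻¹-involutive _) ⟩
          x ⊕ x ⊛ z            ∎

        -- For y ≠ 0, writing y + z as (1 + z y⁻¹) y reduces the claim to `⊛-one-plus`.
        ⊛-distribˡ : ∀ x y z → x ⊛ (y ⊕ z) ≡ x ⊛ y ⊕ x ⊛ z
        ⊛-distribˡ x y z = helper (y Fin.≟ 𝟘)
          where
          helper : Dec (y ≡ 𝟘) → x ⊛ (y ⊕ z) ≡ x ⊛ y ⊕ x ⊛ z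
          helper (yes refl) = begin
            x ⊛ (𝟘 ⊕ z)        ≡⟨ cong (x ⊛_) (identityˡ z) ⟩
            x ⊛ z              ≡⟨ identityˡ _ ⟨
            𝟘 ⊕ x ⊛ z          ≡⟨ cong (_⊕ x ⊛ z) (⊛-zeroʳ x) ⟨
            x ⊛ 𝟘 ⊕ x ⊛ z      ∎
          helper (no y≢0) = begin
            x ⊛ (y ⊕ z)                    ≡⟨ cong (x ⊛_) (cong₂ _⊕_ (⊛-identityˡ y) zty) ⟨
            x ⊛ (𝟙 ⊛ y ⊕ z ⊛ t ⊛ y)        ≡⟨ cong (x ⊛_) (⊛-distribʳ y 𝟙 (z ⊛ t)) ⟨
            x ⊛ ((𝟙 ⊕ z ⊛ t) ⊛ y)          ≡⟨ ⊛-assoc x (𝟙 ⊕ z ⊛ t) y ⟨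
            x ⊛ (𝟙 ⊕ z ⊛ t) ⊛ y            ≡⟨ cong (_⊛ y) (⊛-one-plus x (z ⊛ t)) ⟩
            (x ⊕ x ⊛ (z ⊛ t)) ⊛ y          ≡⟨ ⊛-distribʳ y x (x ⊛ (z ⊛ t)) ⟩
            x ⊛ y ⊕ x ⊛ (z ⊛ t) ⊛ y        ≡⟨ cong (x ⊛ y ⊕_) (⊛-assoc x (z ⊛ t) y) ⟩
            x ⊛ y ⊕ x ⊛ (z ⊛ t ⊛ y)        ≡⟨ cong (λ w → x ⊛ y ⊕ x ⊛ w) zty ⟩
            x ⊛ y ⊕ x ⊛ z                  ∎
            where
            t = proj₁ (⊛-inverse y y≢0)
            zty : z ⊛ t ⊛ y ≡ z
            zty = trans (⊛-assoc z t y) (trans (cong (z ⊛_) (proj₂ (⊛-inverse y y≢0))) (⊛-identityʳ z))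

        isRing : IsRing _≡_ _⊕_ _⊛_ ⊖_ 𝟘 𝟙
        isRing = record
          { +-isAbelianGroup = ⊕-isAbelianGroup
          ; *-cong = cong₂ _⊛_
          ; *-assoc = ⊛-assoc
          ; *-identity = ⊛-identityˡ , ⊛-identityʳ
          ; distrib = ⊛-distribˡ , ⊛-distribʳ
          }

        divisionRing : FiniteDivisionRing (q ℕ.^ n)
        divisionRing = record { isRing = isRing ; 0≢1 = 𝟙≢𝟘 ∘ sym ; inverse = ⊛-inverse }

        abstract
          ⊛-comm : ∀ x y → x ⊛ y ≡ y ⊛ x
          ⊛-comm = wedderburn divisionRing

        K : Field
        K = record
          { isCommutativeRing = record { isRing = isRing ; *-comm = ⊛-comm }
          ; 0≢1 = 𝟙≢𝟘 ∘ sym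
          ; inverse = λ x x≢0 → let t , tx≡1 = ⊛-inverse x x≢0 in t , trans (⊛-comm x t) tx≡1
          }

        σ : FieldHom F K
        σ = record
          { map = _⊙ 𝟙
          ; map-+ = λ c d → ⊙-distribʳ c d 𝟙
          ; map-* = λ c d → trans (⊙-assoc c d 𝟙) (sym (⊙𝟙-⊛ c (d ⊙ 𝟙)))
          ; map-1 = ⊙-identityˡ 𝟙
          }
          where
          ⊙𝟙-⊛ : ∀ c x → (c ⊙ 𝟙) ⊛ x ≡ c ⊙ x
          ⊙𝟙-⊛ c x = trans (⊙-⊛ c 𝟙 x) (cong (c ⊙_) (⊛-identityˡ x))

        π-semilinear : ∀ c v d → π d (c · v) ≡ (c ⊙ 𝟙) ⊛ π d v
        π-semilinear c v d = trans (π-· d c v) (sym (trans (⊙-⊛ c 𝟙 _) (cong (c ⊙_) (⊛-identityˡ _))))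

        -- Let w₁ be the point of k with d-coordinate 𝟙. Each v in k is π d v times w₁, and w is π d
        -- w times w₁, whence the scalar π d v ⊛ t with t the inverse of π d w.
        element⇔line : ∀ {k w d} → k ∋ w → π d w ≢ 𝟘 → ∀ v → k ∋ v ⇔ ∃ λ s → ∀ j → π j v ≡ s ⊛ π j w
        element⇔line {k} {w} {d} w∈ πdw≢0 v with lift w∈ πdw≢0 𝟙
        ... | w₁ , w₁∈ , πdw₁ = mk⇔ to from
          where
          t = proj₁ (⊛-inverse (π d w) πdw≢0)
          t⊛ = proj₂ (⊛-inverse (π d w) πdw≢0)
          to : k ∋ v → ∃ λ s → ∀ j → π j v ≡ s ⊛ π j w
          to v∈ = π d v ⊛ t , λ j → begin
            π j v                            ≡⟨ multiplicative d j w₁∈ v∈ πdw₁ ⟩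
            π d v ⊛ π j w₁                   ≡⟨ cong (_⊛ π j w₁) (⊛-identityʳ (π d v)) ⟨
            π d v ⊛ 𝟙 ⊛ π j w₁               ≡⟨ cong (λ s → π d v ⊛ s ⊛ π j w₁) t⊛ ⟨
            π d v ⊛ (t ⊛ π d w) ⊛ π j w₁     ≡⟨ cong (_⊛ π j w₁) (⊛-assoc (π d v) t (π d w)) ⟨
            π d v ⊛ t ⊛ π d w ⊛ π j w₁       ≡⟨ ⊛-assoc (π d v ⊛ t) (π d w) (π j w₁) ⟩
            π d v ⊛ t ⊛ (π d w ⊛ π j w₁)     ≡⟨ cong (π d v ⊛ t ⊛_) (multiplicative d j w₁∈ w∈ πdw₁) ⟨
            π d v ⊛ t ⊛ π j w                ∎
          from : (∃ λ s → ∀ j → π j v ≡ s ⊛ π j w) → k ∋ v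
          from (s , eq) =
            let y , y∈ , πdy = lift w∈ πdw≢0 (s ⊛ π d w)
            in span-resp (π-ext (λ j → begin
              π j y                      ≡⟨ multiplicative d j w₁∈ y∈ πdw₁ ⟩
              π d y ⊛ π j w₁             ≡⟨ cong (_⊛ π j w₁) πdy ⟩
              s ⊛ π d w ⊛ π j w₁         ≡⟨ ⊛-assoc s (π d w) (π j w₁) ⟩
              s ⊛ (π d w ⊛ π j w₁)       ≡⟨ cong (s ⊛_) (multiplicative d j w₁∈ w∈ πdw₁) ⟨
              s ⊛ π j w                  ≡⟨ eq j ⟨
              π j v                      ∎)) y∈

        element-line : Fin n → ∀ k → ∃ λ (x : Fin r → W) → (∃ λ d → x d ≢ 𝟘) ×
                       (∀ v → k ∋ v ⇔ ∃ λ s → ∀ j → π j v ≡ s ⊛ x j)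
        element-line l k =
          let d , ≢0 = nonzero-coordinate (basis-nonzero k l)
          in (λ j → π j (basis k l)) , (d , ≢0) , element⇔line (span-gen l) ≢0

        line-element : ∀ (x : Fin r → W) → (∃ λ d → x d ≢ 𝟘) →
                       ∃ λ k → ∀ v → k ∋ v ⇔ ∃ λ s → ∀ j → π j v ≡ s ⊛ x j
        line-element x (d , xd≢0) = k , λ v → mk⇔
          (λ v∈ → let s , eq = Equivalence.to (k⇔ v) v∈ in s , λ j → trans (eq j) (cong (s ⊛_) (π-vec j x)))
          (λ (s , eq) → Equivalence.from (k⇔ v) (s , λ j → trans (eq j) (cong (s ⊛_) (sym (π-vec j x)))))
          where
          πd≢0 : π d (vec x) ≢ 𝟘
          πd≢0 eq = xd≢0 (trans (sym (π-vec d x)) eq)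
          k = through πd≢0 𝟘
          k⇔ = element⇔line (through∋ πd≢0 𝟘) πd≢0

-- The extra normal element

third-index : ∀ {k} (a b : Fin (suc (suc (suc k)))) → ∃ λ c → c ≢ a × c ≢ b
third-index (Fin.suc a) (Fin.suc b) = Fin.zero , (λ ()) , (λ ())
third-index Fin.zero Fin.zero = Fin.suc Fin.zero , (λ ()) , (λ ())
third-index Fin.zero (Fin.suc Fin.zero) = Fin.suc (Fin.suc Fin.zero) , (λ ()) , (λ ())
third-index Fin.zero (Fin.suc (Fin.suc b)) = Fin.suc Fin.zero , (λ ()) , (λ ())
third-index (Fin.suc Fin.zero) Fin.zero = Fin.suc (Fin.suc Fin.zero) , (λ ()) , (λ ())
third-index (Fin.suc (Fin.suc a)) Fin.zero = Fin.suc Fin.zero , (λ ()) , (λ ())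

-- Otherwise a choice of preimages would inject `Fin (suc r)` into `Fin r`. The missed index gives
-- the extra normal element.
missed-index : ∀ {r} (j : Fin r → Fin (suc r)) → ∃ λ s → ∀ a → j a ≢ s
missed-index {r} j with Fin.any? (λ s → Fin.all? (λ a → ¬? (j a Fin.≟ s)))
... | yes missed = missed
... | no none = contradiction (Fin.injective⇒≤ preimage-injective) ℕ.1+n≰n
  where
  hit : ∀ s → ∃ λ a → j a ≡ s
  hit s = decidable-stable (Fin.any? (λ a → j a Fin.≟ s)) (λ none′ → none (s , λ a eq → none′ (a , eq)))
  preimage-injective : Injective _≡_ _≡_ (proj₁ ∘ hit)
  preimage-injective {s} {s′} eq = trans (sym (proj₂ (hit s))) (trans (cong j eq) (proj₂ (hit s′)))

module ExtraNormalElement (F : Field) {q : ℕ} (order : HasOrder F q) {r-3 n : ℕ}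
  (S : Spread F (suc (suc (suc r-3)) ℕ.* n) n) (1≤n : 1 ℕ.≤ n) where
  open VectorSpace F
  open Spread S
  open LinearAlgebra F order
  open Codes n
  open Elements F order S

  r : ℕ
  r = suc (suc (suc r-3))

  module InFrame {e : Fin r → Index} (coords : Coordinates F order S e) (e-normal : ∀ a → Normal S (e a))
    {E : Index} (E-normal : Normal S E) (E≢e : ∀ a → E ≢ e a) where
    open InCoordinates coords e-normal

    g : Vect (r ℕ.* n)
    g = basis E (Fin.fromℕ< 1≤n)

    g∈ : E ∋ g
    g∈ = span-gen _

    g-nonzero : NonZero g
    g-nonzero = basis-nonzero E _

    abstract
      -- A vector with a single nonzero coordinate lies on an axis, and `E` is none of the axes.
      two-coordinates : ∃₂ λ a b → a ≢ b × π a g ≢ 𝟘 × π b g ≢ 𝟘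
      two-coordinates with nonzero-coordinate g-nonzero
      ... | a , πag≢0 with Fin.any? (λ b → ¬? (a Fin.≟ b) ×-dec support? g b)
      ...   | yes (b , a≢b , πbg≢0) = a , b , a≢b , πag≢0 , πbg≢0
      ...   | no none = contradiction (disjoint E (e a) g g-nonzero g∈ (axis⇐ (λ b b≢a →
                decidable-stable (π b g Fin.≟ 𝟘) (λ πbg≢0 → none (b , b≢a ∘ sym , πbg≢0))))) (E≢e a)

    module _ {a b} (a≢b : a ≢ b) (πag≢0 : π a g ≢ 𝟘) (πbg≢0 : π b g ≢ 𝟘) where
      o p : Fin r
      o = Fin.zero
      p = Fin.suc Fin.zero

      p≢o : p ≢ o
      p≢o ()

      -- The element through u becomes the diagonal {(x , … , x)}, so that E becomes its
      -- projection onto the support of g.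
      u : Vect (r ℕ.* n)
      u = vec (λ c → choose (support? g c) (π c g) (π a g))

      π-u : ∀ {c} → π c g ≢ 𝟘 → π c u ≡ π c g
      π-u {c} ≢0 = trans (π-vec c _) (choose-yes (support? g c) ≢0)

      full : ∀ c → π c u ≢ 𝟘
      full c πcu≡0 = helper (support? g c)
        where
        helper : ¬ Dec (π c g ≢ 𝟘)
        helper (yes ≢0) = ≢0 (trans (sym (π-u ≢0)) πcu≡0)
        helper (no ¬≢0) = πag≢0 (trans (sym (trans (π-vec c _) (choose-no (support? g c) ¬≢0))) πcu≡0)

      U : Index
      U = proj₁ (covers u (nonzero-at (full o)))

      u∈ : U ∋ u
      u∈ = proj₂ (covers u (nonzero-at (full o)))

      open Normalisation o u∈ full

      -- Where g is nonzero it agrees with u, whose rescaled coordinates are all equal; their common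
      -- value is the 𝟙 of the nearfield.
      rescale-g : ∀ {c} → π c g ≢ 𝟘 → rescale c g ≡ rescale o u
      rescale-g {c} ≢0 = trans (rescale-local {c} {g} {u} (sym (π-u ≢0))) (trans (rescale-diagonal u∈ c) (sym (rescale-diagonal u∈ o)))

      πou≢0 : rescale o u ≢ 𝟘
      πou≢0 eq = full o (rescale-zero⁻¹ {o} {u} eq)

      rescaled-diagonal : ∀ {x} → U ∋ x → ∀ c → rescale c x ≡ rescale o x
      rescaled-diagonal x∈ c = trans (rescale-diagonal x∈ c) (sym (rescale-diagonal x∈ o))

      rescaled-g : ∀ c → rescale c g ≡ 𝟘 ⊎ rescale c g ≡ rescale o u
      rescaled-g c = helper (π c g Fin.≟ 𝟘)
        where
        helper : Dec (π c g ≡ 𝟘) → rescale c g ≡ 𝟘 ⊎ rescale c g ≡ rescale o u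
        helper (yes ≡0) = inj₁ (rescale-zero {c} {g} ≡0)
        helper (no ≢0) = inj₂ (rescale-g ≢0)

      private module R = InCoordinates rescaled e-normal
      open R.Nearfield.Distributivity p≢o third-index u∈ πou≢0 rescaled-diagonal E-normal a≢b g∈
        (rescale-g πag≢0) (rescale-g πbg≢0) rescaled-g

      desarguesian-at : Desarguesian r n S
      desarguesian-at = K , σ , (λ v d → R.π d v)
        , (λ v w v≈w d → R.π-cong d v≈w)
        , (λ v w d → R.π-+ d v w)
        , π-semilinear
        , (λ v w → R.π-ext)
        , (λ x → R.vec x , λ d → R.π-vec d x)
        , element-line (Fin.fromℕ< 1≤n)
        , line-element

    desarguesian : Desarguesian r n S
    desarguesian = let a , b , a≢b , πag≢0 , πbg≢0 = two-coordinates in desarguesian-at a≢b πag≢0 πbg≢0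

open import Data.Nat using (_*_; _≤_)

theorem5p11 : (F : Field) (q r n : ℕ) → OddPrimePower q → HasOrder F q →
    3 ≤ r → 1 ≤ n → (S : Spread F (r * n) n) →
    (Σ (Fin (suc r) → Spread.Index S) λ e →
    Injective _≡_ _≡_ e
    × (∀ a → Normal S (e a))
    × (Σ (Fin r → Fin (suc r)) λ j → Injective _≡_ _≡_ j
    × (∀ v → VectorSpace.InSpan F
    (λ (p : Σ (Fin r) λ _ → Fin n) → Spread.basis S (e (j (Σ.proj₁ p))) (Σ.proj₂ p))
    v))) →
    Desarguesian r n S
theorem5p11 F q r n _ order (ℕ.s≤s (ℕ.s≤s (ℕ.s≤s ℕ.z≤n))) 1≤n S (e , e-injective , e-normal , j , _ , spanning) =
  -- Injectivity of `e` makes the normal element at `s` different from each of the spanning ones.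
  let s , missed = missed-index j in
  ExtraNormalElement.InFrame.desarguesian F order S 1≤n
    (SpanningElements.coordinates F order S (e ∘ j) spanning) (e-normal ∘ j)
    (e-normal s) (λ a eq → missed a (sym (e-injective eq)))
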